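{- Let $n,k,p$ be non-negative integers with $p(k^2-1) \le n$, and let $\mathscr{F}$ be a family of $t$ graphs, each with $n$ vertices, $k$-colorable, and of pathwidth at most $p$. If $t \ge \max\{4k^2, 811\}$, then \[ \mathscr{U}(\mathscr{F}) ~<~ \frac{15}{7}\sqrt{t}\, n . \]
   Context: A graph $U$ is an induced-universal graph for a family $\mathscr{F}$ if every graph of $\mathscr{F}$ is isomorphic to an induced subgraph of $U$; $\mathscr{U}(\mathscr{F})$ is the smallest number of vertices of such a $U$. -}

module Defs where

open import Data.Bool using (Bool; true; false; T; not; _∧_; _∨_)
open import Data.Bool.Properties using (∨-comm; ∨-idem) renaming (_≟_ to _≟ᵇ_)
open import Data.Fin using (Fin; _≤_; combine; remQuot; finToFun; funToFin)
open import Data.Fin.Properties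
  using (_≟_; any?; all?; remQuot-combine; combine-injectiveʳ; finToFun-funToFin)
open import Data.Fin.Subset using (Subset; _∈_; ∣_∣)
open import Data.Fin.Subset.Properties using (anySubset?)
open import Data.Nat using (ℕ; suc; _*_; _^_) renaming (_≤_ to _≤ᴺ_; _<_ to _<ᴺ_)
open import Data.Nat.Induction using (<-rec)
open import Data.Nat.Properties using (anyUpTo?; ≮⇒≥)
open import Data.Product using (Σ; ∃; ∃-syntax; _×_; _,_; proj₁; proj₂)
open import Data.Vec using (lookup; tabulate)
open import Data.Vec.Properties using (lookup∘tabulate; []=⇒lookup; lookup⇒[]=)
open import Data.Vec.Properties.WithK using ([]=-irrelevant)
open import Function using (_∘_; _↔_; Inverse; mk↔ₛ′)
open import Relation.Binary.PropositionalEquality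
open import Relation.Nullary using (Dec; yes; no; does; contradiction; _×-dec_; _→-dec_)
open import Relation.Nullary.Decidable using (map′; dec-true)
open import Relation.Unary using (Decidable)

-- Simple graphs, with decidable adjacency.
record Graph (V : Set) : Set where
  field
    adj    : V → V → Bool
    symm   : ∀ u v → adj u v ≡ adj v u
    irrefl : ∀ v → adj v v ≡ false

open Graph public

record _≅_ {V W : Set} (G : Graph V) (H : Graph W) : Set where
  field
    bijection : V ↔ W
    preserves : ∀ u v →
      adj G u v ≡ adj H (Inverse.to bijection u) (Inverse.to bijection v)

open _≅_ public

infix 4 _≅_

induced : ∀ {m} → Graph (Fin m) → (S : Subset m) → Graph (∃[ v ] v ∈ S)
induced U S .adj (u , _) (v , _) = adj U u v
induced U S .symm (u , _) (v , _) = symm U u v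
induced U S .irrefl (v , _)      = irrefl U v

Colorable : ∀ {n} → ℕ → Graph (Fin n) → Set
Colorable {n} k G =
  Σ (Fin n → Fin k) λ c → ∀ u v → T (adj G u v) → c u ≢ c v

record PathDecomposition {n} (G : Graph (Fin n)) : Set where
  field
    length   : ℕ
    bag      : Fin length → Subset n
    vertices : ∀ v → ∃[ i ] v ∈ bag i
    edges    : ∀ u v → T (adj G u v) → ∃[ i ] (u ∈ bag i × v ∈ bag i)
    interval : ∀ {i j l} v → i ≤ j → j ≤ l → v ∈ bag i → v ∈ bag l → v ∈ bag j

open PathDecomposition public

-- The width is the maximum of ∣ bag i ∣ - 1, hence the successor.
WidthAtMost : ∀ {n} {G : Graph (Fin n)} → ℕ → PathDecomposition G → Set
WidthAtMost p D = ∀ i → ∣ bag D i ∣ ≤ᴺ suc p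

PathwidthAtMost : ∀ {n} → ℕ → Graph (Fin n) → Set
PathwidthAtMost p G = Σ (PathDecomposition G) (WidthAtMost p)

-- Indexed, so isomorphic or even equal members are allowed.
Family : ℕ → ℕ → Set
Family t n = Fin t → Graph (Fin n)

InducedUniversal : ∀ {t n m} → Family t n → Graph (Fin m) → Set
InducedUniversal F U = ∀ i → ∃[ S ] F i ≅ induced U S

HasInducedUniversal : ∀ {t n} → Family t n → ℕ → Set
HasInducedUniversal F m = Σ (Graph (Fin m)) (InducedUniversal F)

IsLeast : (ℕ → Set) → ℕ → Set
IsLeast P m = P m × (∀ m′ → P m′ → m ≤ᴺ m′)

-- The least order of an induced-universal graph exists constructively: the
-- disjoint union of the family is one, and having one on m vertices is
-- decidable, since isomorphisms onto induced subgraphs amount to embeddings.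

record _↪_ {n m} (G : Graph (Fin n)) (U : Graph (Fin m)) : Set where
  constructor embedding
  field
    fun       : Fin n → Fin m
    injective : ∀ u v → fun u ≡ fun v → u ≡ v
    preserves : ∀ u v → adj G u v ≡ adj U (fun u) (fun v)

module _ {n m} {G : Graph (Fin n)} {U : Graph (Fin m)} where

  ≅induced⇒↪ : ∃[ S ] G ≅ induced U S → G ↪ U
  ≅induced⇒↪ (S , e) = embedding (proj₁ ∘ to)
    (λ u v eq → trans (sym (strictlyInverseʳ u))
                  (trans (cong from (∈-≡ eq)) (strictlyInverseʳ v)))
    (preserves e)
    where
    open Inverse (bijection e)
    ∈-≡ : {x y : ∃[ v ] v ∈ S} → proj₁ x ≡ proj₁ y → x ≡ y
    ∈-≡ {x , p} {.x , q} refl = cong (x ,_) ([]=-irrelevant p q)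

  ↪⇒≅induced : G ↪ U → ∃[ S ] G ≅ induced U S
  ↪⇒≅induced (embedding f inj pres) = image , record
    { bijection = mk↔ₛ′ (λ u → f u , f∈ u) (λ (v , p) → proj₁ (preimage v p))
        (λ (v , p) → ∈-≡ (proj₂ (preimage v p)))
        (λ u → inj _ _ (proj₂ (preimage (f u) (f∈ u))))
    ; preserves = pres }
    where
    hit? : ∀ v → Dec (∃[ u ] f u ≡ v)
    hit? v = any? (λ u → f u ≟ v)

    image : Subset m
    image = tabulate (does ∘ hit?)

    f∈ : ∀ u → f u ∈ image
    f∈ u = lookup⇒[]= (f u) image
      (trans (lookup∘tabulate _ (f u)) (dec-true (hit? (f u)) (u , refl)))

    preimage : ∀ v → v ∈ image → ∃[ u ] f u ≡ v
    preimage v p with hit? v | trans (sym (lookup∘tabulate (does ∘ hit?) v)) ([]=⇒lookup p)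
    ... | yes h | _ = h
    ... | no _  | ()

    ∈-≡ : {x y : ∃[ v ] v ∈ image} → proj₁ x ≡ proj₁ y → x ≡ y
    ∈-≡ {x , p} {.x , q} refl = cong (x ,_) ([]=-irrelevant p q)

_↪?_ : ∀ {n m} (G : Graph (Fin n)) (U : Graph (Fin m)) → Dec (G ↪ U)
_↪?_ {n} {m} G U = map′
  (λ (i , inj , pres) → embedding (finToFun i) inj pres)
  (λ (embedding f inj pres) → funToFin f
    , (λ u v eq → inj u v
        (trans (sym (finToFun-funToFin f u)) (trans eq (finToFun-funToFin f v))))
    , (λ u v → trans (pres u v)
        (sym (cong₂ (adj U) (finToFun-funToFin f u) (finToFun-funToFin f v)))))
  (any? {n = m ^ n} λ i →
    (all? λ u → all? λ v → (finToFun i u ≟ finToFun i v) →-dec (u ≟ v))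
    ×-dec
    (all? λ u → all? λ v → adj G u v ≟ᵇ adj U (finToFun i u) (finToFun i v)))

inducedUniversal? : ∀ {t n m} (F : Family t n) (U : Graph (Fin m)) →
                    Dec (InducedUniversal F U)
inducedUniversal? F U = all? λ i → map′ ↪⇒≅induced ≅induced⇒↪ (F i ↪? U)

-- Every 0/1 matrix gives a graph by symmetrizing and clearing the diagonal;
-- every graph arises in this way, up to pointwise equality of adj.
fromMatrix : ∀ {m} → Subset (m * m) → Graph (Fin m)
fromMatrix A .adj u v =
  not (does (u ≟ v)) ∧ (lookup A (combine u v) ∨ lookup A (combine v u))
fromMatrix A .symm u v
  with u ≟ v | v ≟ u
... | yes _  | yes _  = refl
... | no _   | no _   = ∨-comm (lookup A (combine u v)) _
... | yes eq | no ¬eq = contradiction (sym eq) ¬eq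
... | no ¬eq | yes eq = contradiction (sym eq) ¬eq
fromMatrix A .irrefl v rewrite dec-true (v ≟ v) refl = refl

toMatrix : ∀ {m} → Graph (Fin m) → Subset (m * m)
toMatrix {m} U = tabulate λ e → adj U (proj₁ (remQuot {m} m e)) (proj₂ (remQuot {m} m e))

lookup-toMatrix : ∀ {m} (U : Graph (Fin m)) u v →
                  lookup (toMatrix U) (combine u v) ≡ adj U u v
lookup-toMatrix U u v = trans (lookup∘tabulate _ (combine u v))
  (cong (λ (x , y) → adj U x y) (remQuot-combine u v))

adj-fromMatrix : ∀ {m} (U : Graph (Fin m)) u v →
                 adj U u v ≡ adj (fromMatrix (toMatrix U)) u v
adj-fromMatrix U u v with u ≟ v
... | yes refl = irrefl U u
... | no _ rewrite lookup-toMatrix U u v | lookup-toMatrix U v u | symm U v u =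
  sym (∨-idem (adj U u v))

hasInducedUniversal? : ∀ {t n} (F : Family t n) → Decidable (HasInducedUniversal F)
hasInducedUniversal? F m = map′
  (λ (A , univ) → fromMatrix A , univ)
  (λ (U , univ) → toMatrix U , λ i → let S , e = univ i in S , record
    { bijection = bijection e
    ; preserves = λ u v → trans (preserves e u v) (adj-fromMatrix U _ _) })
  (anySubset? λ A → inducedUniversal? F (fromMatrix A))

adj⊎ : ∀ {t n} → Family t n → Fin t × Fin n → Fin t × Fin n → Bool
adj⊎ F (i , u) (j , v) = does (i ≟ j) ∧ adj (F i) u v

disjointUnion : ∀ {t n} → Family t n → Graph (Fin (t * n))
disjointUnion {t} {n} F = record
  { adj    = λ x y → adj⊎ F (remQuot {t} n x) (remQuot {t} n y)
  ; symm   = λ x y → symm⊎ (remQuot {t} n x) (remQuot {t} n y)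
  ; irrefl = λ x → irrefl⊎ (remQuot {t} n x) }
  where
  symm⊎ : ∀ x y → adj⊎ F x y ≡ adj⊎ F y x
  symm⊎ (i , u) (j , v) with i ≟ j | j ≟ i
  ... | yes refl | yes _  = symm (F i) u v
  ... | no _     | no _   = refl
  ... | yes eq   | no ¬eq = contradiction (sym eq) ¬eq
  ... | no ¬eq   | yes eq = contradiction (sym eq) ¬eq

  irrefl⊎ : ∀ x → adj⊎ F x x ≡ false
  irrefl⊎ (i , u) rewrite dec-true (i ≟ i) refl = irrefl (F i) u

disjointUnion-universal : ∀ {t n} (F : Family t n) → InducedUniversal F (disjointUnion F)
disjointUnion-universal {t} {n} F i = ↪⇒≅induced (embedding (combine i)
  (λ u v → combine-injectiveʳ i u i v) pres)
  where
  pres : ∀ u v → adj (F i) u v ≡ adj (disjointUnion F) (combine i u) (combine i v)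
  pres u v = trans
    (sym (cong (_∧ adj (F i) u v) (dec-true (i ≟ i) refl)))
    (sym (cong₂ (adj⊎ F) (remQuot-combine i u) (remQuot-combine i v)))

least : ∀ {P : ℕ → Set} → Decidable P → ∃ P → ∃ (IsLeast P)
least {P} P? (b , Pb) = <-rec (λ m → P m → ∃ (IsLeast P)) step b Pb
  where
  step : ∀ m → (∀ {m′} → m′ <ᴺ m → P m′ → ∃ (IsLeast P)) → P m → ∃ (IsLeast P)
  step m rec Pm with anyUpTo? P? m
  ... | yes (m′ , m′<m , Pm′) = rec m′<m Pm′
  ... | no none = m , Pm , λ m′ Pm′ → ≮⇒≥ λ m′<m → none (m′ , m′<m , Pm′)

leastInducedUniversal : ∀ {t n} (F : Family t n) → ∃ (IsLeast (HasInducedUniversal F))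
leastInducedUniversal F =
  least (hasInducedUniversal? F) (_ , disjointUnion F , disjointUnion-universal F)

𝒰 : ∀ {t n} → Family t n → ℕ
𝒰 F = proj₁ (leastInducedUniversal F)

{-# OPTIONS --safe #-}

-- Take a prime q with t ≤ q² ≤ 3.2 t and cut the colour classes of every graph into parts
-- of at most s vertices, where s ≈ n / (q - k), so that there are at most q parts; list
-- them by decreasing size.  The graph with index (a, b) ∈ (ℤ / q)² puts its part number x
-- into the block (x, a x + b) of the universal graph.  Two lines meet in at most one point,
-- so two graphs share at most one block, and both are edgeless inside it.  At most
-- (n + k (s - i)) / s parts have at least i vertices, so the blocks with a given second
-- coordinate need at most n + k (s - 1) / 2 vertices in total.
--
-- The prime q exists because every interval (x, 1.788 x] with x ≥ 28 contains a prime: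
-- explicitly for small x, and by a refinement of Erdős' proof of Bertrand's postulate,
-- which yields a prime in (27i, 48i], for large x.
module Submission where

-- With d = q - k the layout needs at most q (n + k (s - 1) / 2) vertices and s - 1 ≤ n / d, so 𝒰 /
-- n ≤ q (1 + k / (2 d)). From 4 k² ≤ t follows k ≤ √t / 2 ≤ q / 2, and in this range the bound
-- increases with q and with k. Its worst case, q = √3.2 √t and k = √t / 2, is about 2.136 √t, just
-- below 15/7 = 2.142.... Bertrand's postulate alone, with q up to 2 √t, would give only 2.33 √t;
-- hence the shorter prime interval, whose ratio 48/27 = 1.777... leaves room for rounding below
-- √3.2 = 1.788.... Without cutting, the x-th largest colour class is only known to have at most n /
-- x vertices, and the blocks with one second coordinate would add up to a harmonic sum. Sorting
-- makes one sequence of block sizes serve every graph of the family.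

open import Defs
open import Data.Bool using (T; if_then_else_)
open import Data.Empty using (⊥; ⊥-elim)
open import Data.Fin using (Fin; zero; suc; toℕ; fromℕ<; _↑ˡ_; _↑ʳ_; splitAt; combine; remQuot; inject≤)
open import Data.Fin.Properties
  using ( toℕ-injective; toℕ<n; toℕ-fromℕ<; splitAt-↑ˡ; splitAt-↑ʳ; ↑ˡ-injective; ↑ʳ-injective
        ; combine-injective; combine-remQuot; inject≤-injective; any?)
  renaming (_≟_ to _≟ᶠ_)
open import Data.Integer.Divisibility.Signed
  using (divides; ∣⇒∣ᵤ; ∣ᵤ⇒∣; ∣m∣n⇒∣m-n) renaming (_∣_ to _∣ᶻ_)
import Data.Integer.Properties as ℤₚ
import Data.Integer.Tactic.RingSolver as ℤSolver
open import Data.List using ([]; _∷_)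
open import Data.List.Relation.Unary.All using ([]; _∷_)
open import Data.Nat
open import Data.Nat.Combinatorics
  using (_C_; nC1≡n; k>n⇒nCk≡0; nCk+nC[k+1]≡[n+1]C[k+1]; nCk≡n!/k![n-k]!; k![n∸k]!∣n!; nCk≡nC[n∸k])
open import Data.Nat.Divisibility
open import Data.Nat.DivMod
open import Data.Nat.Induction using (<-rec)
open import Data.Nat.Primality
open import Data.Nat.Primality.Factorisation using (factorise; PrimeFactorisation)
open import Data.Nat.Properties
open import Data.Nat.Tactic.RingSolver using (solve-∀)
open import Data.Product using (∃-syntax; _×_; _,_; proj₁; proj₂)
open import Data.Sum using (_⊎_; inj₁; inj₂; [_,_]′)
open import Data.Unit using (tt)
open import Function using (_∘_; id)
open import Relation.Binary using (tri<; tri≈; tri>)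
open import Relation.Binary.PropositionalEquality
open import Relation.Nullary
open import Relation.Nullary.Decidable using (True; toWitness; map′; T?; dec-true; dec-false)

open import Algebra.Properties.Semiring.Sum +-*-semiring
  using (sum; sum-syntax; sum-cong-≗; sum-replicate-zero; ∑-comm; ∑-distrib-+; *-distribʳ-sum; *-distribˡ-sum)

-- Binomial coefficients

[k+1]*[n+1]C[k+1]≡[n+1]*nCk : ∀ n k → suc k * (suc n C suc k) ≡ suc n * (n C k)
[k+1]*[n+1]C[k+1]≡[n+1]*nCk n zero = begin
  1 * (suc n C 1)  ≡⟨ *-identityˡ _ ⟩
  suc n C 1        ≡⟨ nC1≡n (suc n) ⟩
  suc n            ≡⟨ *-identityʳ _ ⟨
  suc n * (n C 0)  ∎
  where open ≡-Reasoning
[k+1]*[n+1]C[k+1]≡[n+1]*nCk zero (suc k) = begin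
  suc (suc k) * (1 C suc (suc k))  ≡⟨ cong (suc (suc k) *_) (k>n⇒nCk≡0 {1} {suc (suc k)} (s≤s (s≤s z≤n))) ⟩
  suc (suc k) * 0                  ≡⟨ *-zeroʳ (suc (suc k)) ⟩
  0                                ≡⟨ cong (1 *_) (k>n⇒nCk≡0 {0} {suc k} (s≤s z≤n)) ⟨
  1 * (0 C suc k)                  ∎
  where open ≡-Reasoning
[k+1]*[n+1]C[k+1]≡[n+1]*nCk (suc m) (suc j) = begin
  (2 + j) * (suc (suc m) C suc (suc j))
    ≡⟨ cong ((2 + j) *_) (nCk+nC[k+1]≡[n+1]C[k+1] (suc m) (suc j)) ⟨
  (2 + j) * (b + c)
    ≡⟨ split j b c ⟩
  b + (suc j * b + (2 + j) * c)
    ≡⟨ cong (b +_) (cong₂ _+_ ([k+1]*[n+1]C[k+1]≡[n+1]*nCk m j) ([k+1]*[n+1]C[k+1]≡[n+1]*nCk m (suc j))) ⟩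
  b + (suc m * (m C j) + suc m * (m C suc j))
    ≡⟨ cong (b +_) (*-distribˡ-+ (suc m) (m C j) (m C suc j)) ⟨
  b + suc m * (m C j + m C suc j)
    ≡⟨ cong (λ x → b + suc m * x) (nCk+nC[k+1]≡[n+1]C[k+1] m j) ⟩
  (2 + m) * (suc m C suc j) ∎
  where
  open ≡-Reasoning
  b = suc m C suc j
  c = suc m C suc (suc j)
  split : ∀ j b c → (2 + j) * (b + c) ≡ b + (suc j * b + (2 + j) * c)
  split = solve-∀

nCk*k!*[n∸k]!≡n! : ∀ {n k} → k ≤ n → (n C k) * (k ! * (n ∸ k) !) ≡ n !
nCk*k!*[n∸k]!≡n! {n} {k} k≤n = trans (cong (_* (k ! * (n ∸ k) !)) (nCk≡n!/k![n-k]! k≤n))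
  (m/n*n≡m (k![n∸k]!∣n! k≤n))
  where instance _ = k !* (n ∸ k) !≢0

nCk>0 : ∀ {n k} → k ≤ n → 0 < n C k
nCk>0 {n} {k} k≤n with n C k | nCk*k!*[n∸k]!≡n! k≤n
... | zero  | 0≡n! = contradiction (sym 0≡n!) (m<n⇒n≢0 (1≤n! n))
... | suc _ | _    = s≤s z≤n

-- One term of the binomial expansion of (m + 1)^n. It is applied to C(27i, 24i) with m = 8: since
-- 24 : 3 = 8 : 1, the term is then the largest one, so little is lost.
nCk*m^k≤[m+1]^n : ∀ m n k → (n C k) * m ^ k ≤ suc m ^ n
nCk*m^k≤[m+1]^n m n zero = subst (_≤ suc m ^ n) (sym (*-identityˡ 1)) (m^n>0 (suc m) n)
nCk*m^k≤[m+1]^n m zero (suc k) =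
  subst (λ x → x * m ^ suc k ≤ 1) (sym (k>n⇒nCk≡0 {0} {suc k} (s≤s z≤n))) z≤n
nCk*m^k≤[m+1]^n m (suc n) (suc k) = begin
  (suc n C suc k) * m ^ suc k
    ≡⟨ cong (_* m ^ suc k) (nCk+nC[k+1]≡[n+1]C[k+1] n k) ⟨
  (n C k + n C suc k) * m ^ suc k
    ≡⟨ regroup (n C k) (n C suc k) m (m ^ k) ⟩
  (n C suc k) * m ^ suc k + m * ((n C k) * m ^ k)
    ≤⟨ +-mono-≤ (nCk*m^k≤[m+1]^n m n (suc k)) (*-monoʳ-≤ m (nCk*m^k≤[m+1]^n m n k)) ⟩
  suc m ^ suc n ∎
  where
  open ≤-Reasoning
  regroup : ∀ a b m x → (a + b) * (m * x) ≡ b * (m * x) + m * (a * x)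
  regroup = solve-∀

centralBinomial : ℕ → ℕ
centralBinomial n = (n + n) C n

2*[2n+1]C[n+1]≡centralBinomial : ∀ n → 2 * (suc (n + n) C suc n) ≡ centralBinomial (suc n)
2*[2n+1]C[n+1]≡centralBinomial n = begin
  2 * (suc (n + n) C suc n)
    ≡⟨ cong ((suc (n + n) C suc n) +_) (+-identityʳ _) ⟩
  (suc (n + n) C suc n) + (suc (n + n) C suc n)
    ≡⟨ cong (_+ (suc (n + n) C suc n)) symmetric ⟩
  (suc (n + n) C n) + (suc (n + n) C suc n)
    ≡⟨ nCk+nC[k+1]≡[n+1]C[k+1] (suc (n + n)) n ⟩
  suc (suc (n + n)) C suc n
    ≡⟨ cong (λ x → suc x C suc n) (+-suc n n) ⟨
  centralBinomial (suc n) ∎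
  where
  open ≡-Reasoning
  symmetric : suc (n + n) C suc n ≡ suc (n + n) C n
  symmetric = trans (nCk≡nC[n∸k] {suc n} {suc (n + n)} (s≤s (m≤m+n n n)))
    (cong (suc (n + n) C_) (m+n∸m≡n n n))

[n+1]*centralBinomial : ∀ n →
  suc n * centralBinomial (suc n) ≡ 2 * suc (n + n) * centralBinomial n
[n+1]*centralBinomial n = begin
  suc n * centralBinomial (suc n)
    ≡⟨ cong (suc n *_) (2*[2n+1]C[n+1]≡centralBinomial n) ⟨
  suc n * (2 * (suc (n + n) C suc n))
    ≡⟨ move (suc n) (suc (n + n) C suc n) ⟩
  2 * (suc n * (suc (n + n) C suc n))
    ≡⟨ cong (2 *_) ([k+1]*[n+1]C[k+1]≡[n+1]*nCk (n + n) n) ⟩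
  2 * (suc (n + n) * centralBinomial n)
    ≡⟨ *-assoc 2 (suc (n + n)) (centralBinomial n) ⟨
  2 * suc (n + n) * centralBinomial n ∎
  where
  open ≡-Reasoning
  move : ∀ a b → a * (2 * b) ≡ 2 * (a * b)
  move = solve-∀

4^n≤[2n+1]*centralBinomial : ∀ n → 4 ^ n ≤ suc (n + n) * centralBinomial n
4^n≤[2n+1]*centralBinomial zero = ≤-refl
4^n≤[2n+1]*centralBinomial (suc n) = begin
  4 * 4 ^ n                                  ≤⟨ *-monoʳ-≤ 4 (4^n≤[2n+1]*centralBinomial n) ⟩
  4 * (suc (n + n) * centralBinomial n)      ≡⟨ double (suc (n + n)) (centralBinomial n) ⟩
  2 * (2 * suc (n + n) * centralBinomial n)  ≡⟨ cong (2 *_) ([n+1]*centralBinomial n) ⟨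
  2 * (suc n * centralBinomial (suc n))      ≡⟨ *-assoc 2 (suc n) _ ⟨
  2 * suc n * centralBinomial (suc n)        ≤⟨ *-monoˡ-≤ (centralBinomial (suc n)) 2[n+1]≤ ⟩
  suc (suc n + suc n) * centralBinomial (suc n) ∎
  where
  open ≤-Reasoning
  double : ∀ a b → 4 * (a * b) ≡ 2 * (2 * a * b)
  double = solve-∀
  2[n+1]≤ : 2 * suc n ≤ suc (suc n + suc n)
  2[n+1]≤ = m≤n⇒m≤1+n (≤-reflexive (cong (suc n +_) (+-identityʳ (suc n))))

centralBinomial[n+1]≤2*4^n : ∀ n → centralBinomial (suc n) ≤ 2 * 4 ^ n
centralBinomial[n+1]≤2*4^n zero = ≤-refl
centralBinomial[n+1]≤2*4^n (suc n) = *-cancelˡ-≤ (2 + n) (begin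
  (2 + n) * centralBinomial (2 + n)                       ≡⟨ [n+1]*centralBinomial (suc n) ⟩
  2 * suc (suc n + suc n) * centralBinomial (suc n)
    ≤⟨ *-mono-≤ (*-monoʳ-≤ 2 odd≤even) (centralBinomial[n+1]≤2*4^n n) ⟩
  2 * ((2 + n) + (2 + n)) * (2 * 4 ^ n)                   ≡⟨ regroup n (4 ^ n) ⟩
  (2 + n) * (2 * (4 * 4 ^ n)) ∎)
  where
  open ≤-Reasoning
  odd≤even : suc (suc n + suc n) ≤ (2 + n) + (2 + n)
  odd≤even = s≤s (+-monoʳ-≤ (suc n) (n≤1+n (suc n)))
  regroup : ∀ n x → 2 * ((2 + n) + (2 + n)) * (2 * x) ≡ (2 + n) * (2 * (4 * x))
  regroup = solve-∀

[2n+1]C[n+1]≤4^n : ∀ n → suc (n + n) C suc n ≤ 4 ^ n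
[2n+1]C[n+1]≤4^n n = *-cancelˡ-≤ 2
  (subst (_≤ 2 * 4 ^ n) (sym (2*[2n+1]C[n+1]≡centralBinomial n)) (centralBinomial[n+1]≤2*4^n n))

-- Leibniz' harmonic triangle: with l(n, k) = 1 / ((n + 1) C(n, k)), one has
-- l(n, k + 1) = l(n - 1, k) - l(n, k), so L l(n, k) is an integer whenever
-- L is a common multiple of 1, …, n + 1.
[n+1]*nCk∣ : ∀ {L} n k → k ≤ n → (∀ i → 1 ≤ i → i ≤ suc n → i ∣ L) → suc n * (n C k) ∣ L
[n+1]*nCk∣ {L} n zero _ divs = subst (_∣ L) (sym (*-identityʳ (suc n))) (divs (suc n) (s≤s z≤n) ≤-refl)
[n+1]*nCk∣ {L} (suc m) (suc k) (s≤s k≤m) divs =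
  -- A = L l(m, k) and B = L l(m + 1, k) are integers by induction, and the quotient is their
  -- difference. Multiplication distributes over `∸`, so the truncation does no harm.
  divides (A ∸ B) (*-cancelˡ-≡ _ _ (suc k) (begin
    suc k * L
      ≡⟨ m+n∸m≡n (b * L) (suc k * L) ⟨
    (b * L + suc k * L) ∸ b * L
      ≡⟨ cong (_∸ b * L) (trans identity (*-comm X A)) ⟩
    A * X ∸ b * L
      ≡⟨ cong (A * X ∸_) step-B ⟩
    A * X ∸ B * X
      ≡⟨ *-distribʳ-∸ X A B ⟨
    (A ∸ B) * X
      ≡⟨ regroup (A ∸ B) (suc k) (2 + m) c ⟩
    suc k * ((A ∸ B) * ((2 + m) * c)) ∎))
  where
  open ≡-Reasoning
  a = m C k
  b₀ = suc m C k
  c = suc m C suc k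
  dA = [n+1]*nCk∣ m k k≤m (λ i 1≤i i≤ → divs i 1≤i (m≤n⇒m≤1+n i≤))
  dB = [n+1]*nCk∣ (suc m) k (m≤n⇒m≤1+n k≤m) divs
  A = quotient dA
  B = quotient dB
  X = suc k * ((2 + m) * c)
  b = suc m ∸ k
  abs : suc k * c ≡ suc m * a
  abs = [k+1]*[n+1]C[k+1]≡[n+1]*nCk m k
  k+b : suc k + b ≡ 2 + m
  k+b = cong suc (m+[n∸m]≡n (m≤n⇒m≤1+n k≤m))
  LA : L ≡ A * (suc m * a)
  LA = _∣_.equality dA
  LB : L ≡ B * ((2 + m) * b₀)
  LB = _∣_.equality dB
  next : b * b₀ ≡ suc k * c
  next = +-cancelˡ-≡ (suc k * b₀) _ _ (begin
    suc k * b₀ + b * b₀        ≡⟨ *-distribʳ-+ b₀ (suc k) b ⟨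
    (suc k + b) * b₀           ≡⟨ cong (_* b₀) k+b ⟩
    (2 + m) * b₀               ≡⟨ [k+1]*[n+1]C[k+1]≡[n+1]*nCk (suc m) k ⟨
    suc k * (suc (suc m) C suc k)  ≡⟨ cong (suc k *_) (nCk+nC[k+1]≡[n+1]C[k+1] (suc m) k) ⟨
    suc k * (b₀ + c)           ≡⟨ *-distribˡ-+ (suc k) b₀ c ⟩
    suc k * b₀ + suc k * c     ∎)
  identity : b * L + suc k * L ≡ X * A
  identity = begin
    b * L + suc k * L           ≡⟨ *-distribʳ-+ L b (suc k) ⟨
    (b + suc k) * L             ≡⟨ cong (_* L) (trans (+-comm b (suc k)) k+b) ⟩
    (2 + m) * L                 ≡⟨ cong ((2 + m) *_) LA ⟩
    (2 + m) * (A * (suc m * a)) ≡⟨ cong (λ x → (2 + m) * (A * x)) abs ⟨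
    (2 + m) * (A * (suc k * c)) ≡⟨ regroup₂ (2 + m) A (suc k) c ⟩
    X * A                       ∎
    where
    regroup₂ : ∀ m A k c → m * (A * (k * c)) ≡ k * (m * c) * A
    regroup₂ = solve-∀
  step-B : b * L ≡ B * X
  step-B = begin
    b * L                       ≡⟨ cong (b *_) LB ⟩
    b * (B * ((2 + m) * b₀))    ≡⟨ regroup₃ b B (2 + m) b₀ ⟩
    B * ((2 + m) * (b * b₀))    ≡⟨ cong (λ x → B * ((2 + m) * x)) next ⟩
    B * ((2 + m) * (suc k * c)) ≡⟨ regroup₄ B (2 + m) (suc k) c ⟩
    B * X ∎
    where
    regroup₃ : ∀ b B m x → b * (B * (m * x)) ≡ B * (m * (b * x))
    regroup₃ = solve-∀
    regroup₄ : ∀ B m k c → B * (m * (k * c)) ≡ B * (k * (m * c))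
    regroup₄ = solve-∀
  regroup : ∀ D k m c → D * (k * (m * c)) ≡ k * (D * (m * c))
  regroup = solve-∀

-- Prime powers

prime>1 : ∀ {p} → Prime p → 1 < p
prime>1 {p} pp = nonTrivial⇒n>1 p {{prime⇒nonTrivial pp}}

prime∣⇒≤ : ∀ {p n} → 0 < n → p ∣ n → p ≤ n
prime∣⇒≤ {n = suc _} _ = ∣⇒≤

prime∤* : ∀ {p} → Prime p → ∀ {m n} → p ∤ m → p ∤ n → p ∤ m * n
prime∤* pp {m} {n} p∤m p∤n = [ p∤m , p∤n ]′ ∘ euclidsLemma m n pp

splitPower : ∀ {p} → Prime p → ∀ n → 0 < n → ∃[ e ] ∃[ u ] (n ≡ p ^ e * u × p ∤ u)
splitPower {p} pp = <-rec _ step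
  where
  instance _ = prime⇒nonTrivial pp
  step : ∀ n → (∀ {m} → m < n → 0 < m → ∃[ e ] ∃[ u ] (m ≡ p ^ e * u × p ∤ u)) →
         0 < n → ∃[ e ] ∃[ u ] (n ≡ p ^ e * u × p ∤ u)
  step n@(suc _) rec _ with p ∣? n
  ... | no p∤n = 0 , n , sym (*-identityˡ n) , p∤n
  ... | yes p∣n with rec (quotient-< p∣n) (>-nonZero⁻¹ _ {{quotient≢0 p∣n}})
  ... | e , u , eq , p∤u = suc e , u
    , trans (m∣n⇒n≡m*quotient p∣n) (trans (cong (p *_) eq) (sym (*-assoc p (p ^ e) u)))
    , p∤u

splitPower>0 : ∀ {n} m {u} → 0 < n → n ≡ m * u → 0 < u
splitPower>0 m {zero}  0<n eq = contradiction (trans eq (*-zeroʳ m)) (m<n⇒n≢0 0<n)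
splitPower>0 m {suc _} _   _  = s≤s z≤n

power∣⇒exponent≤ : ∀ {p M} → Prime p → p ∤ M → ∀ e f → p ^ e ∣ p ^ f * M → e ≤ f
power∣⇒exponent≤ pp p∤M zero f _ = z≤n
power∣⇒exponent≤ {p} {M} pp p∤M (suc e) zero d =
  contradiction (∣-trans (m∣m*n (p ^ e)) (subst (p * p ^ e ∣_) (*-identityˡ M) d)) p∤M
power∣⇒exponent≤ {p} {M} pp p∤M (suc e) (suc f) d = s≤s (power∣⇒exponent≤ pp p∤M e f
  (*-cancelˡ-∣ p {{prime⇒nonZero pp}} (subst (p * p ^ e ∣_) (*-assoc p (p ^ f) M) d)))

^-monoʳ-∣ : ∀ p {e f} → e ≤ f → p ^ e ∣ p ^ f
^-monoʳ-∣ p {e} {f} e≤f = subst (p ^ e ∣_) p^f (m∣m*n (p ^ (f ∸ e)))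
  where
  p^f : p ^ e * p ^ (f ∸ e) ≡ p ^ f
  p^f = trans (sym (^-distribˡ-+-* p e (f ∸ e))) (cong (p ^_) (m+[n∸m]≡n e≤f))

-- A stand-in for lcm(1, ..., n + 1) at a single prime: taking the maximum of the exponents keeps
-- the p-part at most n + 1, while the cofactor M may grow freely.
commonMultiple : ∀ {p} → Prime p → ∀ n → ∃[ f ] ∃[ M ]
  (p ^ f ≤ suc n × p ∤ M × (∀ i → 1 ≤ i → i ≤ suc n → i ∣ p ^ f * M))
commonMultiple {p} pp zero = 0 , 1 , ≤-refl , >⇒∤ (prime>1 pp) , λ { 1 _ _ → ∣-refl ; (suc (suc _)) _ (s≤s ()) }
commonMultiple {p} pp (suc n)
  with commonMultiple pp n | splitPower pp (2 + n) (s≤s z≤n)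
... | f , M , p^f≤ , p∤M , divs | a , u , eq , p∤u =
  f ⊔ a , M * u , bound , prime∤* pp p∤M p∤u , divs′
  where
  p^a≤ : p ^ a ≤ 2 + n
  p^a≤ = ∣⇒≤ (subst (p ^ a ∣_) (sym eq) (m∣m*n u))
  bound : p ^ (f ⊔ a) ≤ 2 + n
  bound with ⊔-sel f a
  ... | inj₁ eq′ = subst (λ e → p ^ e ≤ 2 + n) (sym eq′) (m≤n⇒m≤1+n p^f≤)
  ... | inj₂ eq′ = subst (λ e → p ^ e ≤ 2 + n) (sym eq′) p^a≤
  divs′ : ∀ i → 1 ≤ i → i ≤ 2 + n → i ∣ p ^ (f ⊔ a) * (M * u)
  divs′ i 1≤i i≤ with m≤n⇒m<n∨m≡n i≤
  ... | inj₁ (s≤s i≤1+n) = ∣-trans (divs i 1≤i i≤1+n)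
    (*-pres-∣ (^-monoʳ-∣ p (m≤m⊔n f a)) (m∣m*n u))
  ... | inj₂ refl = subst (_∣ p ^ (f ⊔ a) * (M * u)) (sym eq)
    (*-pres-∣ (^-monoʳ-∣ p (m≤n⊔m f a)) (n∣m*n M))

-- Replaces Legendre's formula: (n + 1) C(n, k) divides a common multiple of 1, ..., n + 1 whose
-- p-part is at most n + 1. This bound is the origin of N = 48 i + 1 below.
power∣nCk⇒≤ : ∀ {p} → Prime p → ∀ {e n k} → k ≤ n → p ^ e ∣ n C k → p ^ e ≤ suc n
power∣nCk⇒≤ {p} pp {e} {n} {k} k≤n d with commonMultiple pp n
... | f , M , p^f≤ , p∤M , divs = ≤-trans
  (^-monoʳ-≤ p {{prime⇒nonZero pp}} (power∣⇒exponent≤ pp p∤M e f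
    (∣-trans d (∣-trans (n∣m*n (suc n)) ([n+1]*nCk∣ n k k≤n divs))))) p^f≤

hasPrimeDivisor : ∀ n → 1 < n → ∃[ p ] (Prime p × p ∣ n)
hasPrimeDivisor n@(suc _) 1<n = find (factorise n)
  where
  find : PrimeFactorisation n → ∃[ p ] (Prime p × p ∣ n)
  find record { factors = [] ; isFactorisation = n≡1 } = contradiction n≡1 (>⇒≢ 1<n)
  find record { factors = p ∷ _ ; isFactorisation = eq ; factorsPrime = pp ∷ _ } =
    p , pp , subst (p ∣_) (sym eq) (m∣m*n _)

-- Products over primes

-- The index starts at 1, so `∏ (h ∘ (a +_)) d` runs over the half-open interval (a, a + d]; with
-- `ifPrime` for h only the primes in it count.
∏ : (ℕ → ℕ) → ℕ → ℕ
∏ h zero    = 1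
∏ h (suc n) = h (suc n) * ∏ h n

ifPrime : ℕ → ℕ
ifPrime p = if does (prime? p) then p else 1

ifPrime-prime : ∀ {p} → Prime p → ifPrime p ≡ p
ifPrime-prime {p} pp with prime? p
... | yes _ = refl
... | no ¬p = contradiction pp ¬p

ifPrime-¬prime : ∀ {p} → ¬ Prime p → ifPrime p ≡ 1
ifPrime-¬prime {p} ¬p with prime? p
... | yes pp = contradiction pp ¬p
... | no _   = refl

ifPrime>0 : ∀ p → 0 < ifPrime p
ifPrime>0 p with prime? p
... | yes pp = <-trans (s≤s z≤n) (prime>1 pp)
... | no _   = s≤s z≤n

∏-const : ∀ m n → ∏ (λ _ → m) n ≡ m ^ n
∏-const m zero    = refl
∏-const m (suc n) = cong (m *_) (∏-const m n)

∏-+ : ∀ h m n → ∏ h (m + n) ≡ ∏ h m * ∏ (h ∘ (m +_)) n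
∏-+ h m zero = trans (cong (∏ h) (+-identityʳ m)) (sym (*-identityʳ _))
∏-+ h m (suc n) rewrite +-suc m n | ∏-+ h m n = move (h (suc (m + n))) (∏ h m) _
  where
  move : ∀ a b c → a * (b * c) ≡ b * (a * c)
  move = solve-∀

∏>0 : ∀ h → (∀ i → 0 < h i) → ∀ n → 0 < ∏ h n
∏>0 h h>0 zero    = s≤s z≤n
∏>0 h h>0 (suc n) = *-mono-≤ (h>0 (suc n)) (∏>0 h h>0 n)

PrimesUpTo : ℕ → ℕ → Set
PrimesUpTo b n = ∀ {p} → Prime p → p ∣ n → p ≤ b

-- Divides out the full power of each prime in (a, a + d], starting from the top. Each such power is
-- at most h p, and what remains has no prime factor above a. At composite numbers, h ≥ 1 merely
-- enlarges the product.
strip : ∀ h a d n → 0 < n → PrimesUpTo (a + d) n → (∀ i → 0 < h i) →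
  (∀ {p} e → a < p → Prime p → p ^ e ∣ n → p ^ e ≤ h p) →
  ∃[ m ] (m ∣ n × PrimesUpTo a m × n ≤ m * ∏ (h ∘ (a +_)) d)
strip h a zero n _ smooth _ _ =
  n , ∣-refl , (λ {p} pp p∣n → subst (p ≤_) (+-identityʳ a) (smooth pp p∣n))
  , ≤-reflexive (sym (*-identityʳ n))
strip h a (suc d) n 0<n smooth h>0 bound with prime? (a + suc d)
... | no ¬pp = weaken (strip h a d n 0<n smooth′ h>0 bound)
  where
  smooth′ : PrimesUpTo (a + d) n
  smooth′ {q} pq q∣n with m≤n⇒m<n∨m≡n (smooth pq q∣n)
  ... | inj₁ q< = s≤s⁻¹ (subst (q <_) (+-suc a d) q<)
  ... | inj₂ refl = contradiction pq ¬pp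
  weaken : ∃[ m ] (m ∣ n × PrimesUpTo a m × n ≤ m * ∏ (h ∘ (a +_)) d) →
           ∃[ m ] (m ∣ n × PrimesUpTo a m × n ≤ m * ∏ (h ∘ (a +_)) (suc d))
  weaken (m , m∣n , sm , le) = m , m∣n , sm , ≤-trans le
    (*-monoʳ-≤ m (m≤n*m (∏ (h ∘ (a +_)) d) (h (a + suc d)) {{>-nonZero (h>0 _)}}))
... | yes pp with splitPower pp n 0<n
... | e , u , eq , p∤u = extend
  (strip h a d u (splitPower>0 (p ^ e) 0<n eq) smooth′ h>0 (λ f a<q pq q^f∣u → bound f a<q pq (∣-trans q^f∣u u∣n)))
  where
  p = a + suc d
  u∣n : u ∣ n
  u∣n = subst (u ∣_) (sym eq) (n∣m*n (p ^ e))
  smooth′ : PrimesUpTo (a + d) u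
  smooth′ {q} pq q∣u with m≤n⇒m<n∨m≡n (smooth pq (∣-trans q∣u u∣n))
  ... | inj₁ q< = s≤s⁻¹ (subst (q <_) (+-suc a d) q<)
  ... | inj₂ refl = contradiction q∣u p∤u
  extend : ∃[ m ] (m ∣ u × PrimesUpTo a m × u ≤ m * ∏ (h ∘ (a +_)) d) →
           ∃[ m ] (m ∣ n × PrimesUpTo a m × n ≤ m * ∏ (h ∘ (a +_)) (suc d))
  extend (m , m∣u , sm , le) = m , ∣-trans m∣u u∣n , sm , (begin
    n                               ≡⟨ eq ⟩
    p ^ e * u
      ≤⟨ *-mono-≤ (bound e (m<m+n a (s≤s z≤n)) pp (subst (p ^ e ∣_) (sym eq) (m∣m*n u))) le ⟩
    h p * (m * ∏ (h ∘ (a +_)) d)    ≡⟨ move (h p) m _ ⟩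
    m * (h p * ∏ (h ∘ (a +_)) d)    ∎)
    where
    open ≤-Reasoning
    move : ∀ a b c → a * (b * c) ≡ b * (a * c)
    move = solve-∀

prime∣!⇒≤ : ∀ {p} → Prime p → ∀ n → p ∣ n ! → p ≤ n
prime∣!⇒≤ pp zero p∣1 = contradiction (∣1⇒≡1 p∣1) (>⇒≢ (prime>1 pp))
prime∣!⇒≤ pp (suc n) p∣ with euclidsLemma (suc n) (n !) pp p∣
... | inj₁ p∣1+n = ∣⇒≤ p∣1+n
... | inj₂ p∣n!  = m≤n⇒m≤1+n (prime∣!⇒≤ pp n p∣n!)

-- p divides (a + d)! but neither a! nor d!, as d ≤ a < p.
prime∣C : ∀ {p a d} → Prime p → d ≤ a → a < p → p ≤ a + d → p ∣ (a + d) C a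
prime∣C {p} {a} {d} pp d≤a a<p p≤a+d
  with euclidsLemma ((a + d) C a) (a ! * (a + d ∸ a) !) pp
    (subst (p ∣_) (sym (nCk*k!*[n∸k]!≡n! (m≤m+n a d))) (∣-trans (p∣p! pp) (m≤n⇒m!∣n! p≤a+d)))
  where
  p∣p! : ∀ {p} → Prime p → p ∣ p !
  p∣p! {suc q} _ = m∣m*n (q !)
... | inj₁ p∣C = p∣C
... | inj₂ p∣rest with euclidsLemma (a !) ((a + d ∸ a) !) pp p∣rest
...   | inj₁ p∣a! = contradiction (prime∣!⇒≤ pp a p∣a!) (<⇒≱ a<p)
...   | inj₂ p∣d! = contradiction (prime∣!⇒≤ pp (a + d ∸ a) p∣d!)
  (<⇒≱ (≤-<-trans (subst (_≤ a) (sym (m+n∸m≡n a d)) d≤a) a<p))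

prime∣∏⇒≤ : ∀ {p} → Prime p → ∀ a d → p ∣ ∏ (ifPrime ∘ (a +_)) d → p ≤ a + d
prime∣∏⇒≤ pp a zero p∣1 = contradiction (∣1⇒≡1 p∣1) (>⇒≢ (prime>1 pp))
prime∣∏⇒≤ {p} pp a (suc d) p∣ with euclidsLemma (ifPrime (a + suc d)) _ pp p∣
... | inj₂ p∣∏ = ≤-trans (prime∣∏⇒≤ pp a d p∣∏) (+-monoʳ-≤ a (n≤1+n d))
... | inj₁ p∣i with prime? (a + suc d)
...   | yes pq = prime∣⇒≤ (<-trans (s≤s z≤n) (prime>1 pq)) p∣i
...   | no _ = contradiction (∣1⇒≡1 p∣i) (>⇒≢ (prime>1 pp))

∏ifPrime∣ : ∀ a n → (d : ℕ) → (∀ {p} → Prime p → a < p → p ≤ a + d → p ∣ n) →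
  ∏ (ifPrime ∘ (a +_)) d ∣ n
∏ifPrime∣ a n zero _ = 1∣ n
∏ifPrime∣ a n (suc d) divs = extend (prime? (a + suc d))
  (∏ifPrime∣ a n d (λ pp a<p p≤ → divs pp a<p (≤-trans p≤ (+-monoʳ-≤ a (n≤1+n d)))))
  where
  Q = ∏ (ifPrime ∘ (a +_)) d
  extend : Dec (Prime (a + suc d)) → Q ∣ n → ifPrime (a + suc d) * Q ∣ n
  extend (no ¬pp) Q∣n = subst (_∣ n) (sym (trans (cong (_* Q) (ifPrime-¬prime ¬pp)) (*-identityˡ Q))) Q∣n
  extend (yes pp) Q∣n with euclidsLemma (quotient Q∣n) Q pp
    (subst (a + suc d ∣_) (_∣_.equality Q∣n) (divs pp (m<m+n a (s≤s z≤n)) ≤-refl))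
  ... | inj₁ p∣r = subst₂ (λ x y → x * Q ∣ y) (sym (ifPrime-prime pp)) (sym (_∣_.equality Q∣n)) (*-monoˡ-∣ Q p∣r)
  ... | inj₂ p∣Q = contradiction (prime∣∏⇒≤ pp a d p∣Q) (<⇒≱ (+-monoʳ-< a (n<1+n d)))

∏ifPrime≤C : ∀ a d → d ≤ a → ∏ (ifPrime ∘ (a +_)) d ≤ (a + d) C a
∏ifPrime≤C a d d≤a = prime∣⇒≤ (nCk>0 (m≤m+n a d))
  (∏ifPrime∣ a _ d (λ pp a<p p≤ → prime∣C pp d≤a a<p p≤))

-- Primorials and the prime factors of central binomial coefficients

evenOrOdd : ∀ n → ∃[ m ] (n ≡ m + m ⊎ n ≡ suc (m + m))
evenOrOdd zero = 0 , inj₁ refl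
evenOrOdd (suc n) with evenOrOdd n
... | m , inj₁ refl = m , inj₂ refl
... | m , inj₂ refl = suc m , inj₁ (cong suc (sym (+-suc m m)))

¬prime-even : ∀ m → 1 < m → ¬ Prime (m + m)
¬prime-even m@(suc _) 1<m = composite⇒¬prime
  (composite-≢ 2 (<⇒≢ (≤-trans (s≤s 1<m) (m<m+n m (s≤s z≤n)))) (divides m (double m)))
  where
  double : ∀ m → m + m ≡ m * 2
  double = solve-∀

-- Erdős' induction: an even number above 2 contributes no prime, and the primes in (m + 1, 2 m + 1]
-- have a product of at most C(2 m + 1, m + 1) ≤ 4^m.
primorial≤4^n : ∀ n → ∏ ifPrime n ≤ 4 ^ n
primorial≤4^n = <-rec _ step
  where
  open ≤-Reasoning
  step : ∀ n → (∀ {m} → m < n → ∏ ifPrime m ≤ 4 ^ m) → ∏ ifPrime n ≤ 4 ^ n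
  step n rec with evenOrOdd n
  ... | 0 , inj₁ refl = ≤-refl
  ... | 1 , inj₁ refl = ≤ᵇ⇒≤ (∏ ifPrime 2) 16 tt
  ... | m@(suc (suc k)) , inj₁ refl = begin
    ifPrime (m + m) * ∏ ifPrime (pred (m + m))
      ≡⟨ cong (_* ∏ ifPrime (pred (m + m))) (ifPrime-¬prime (¬prime-even m (s≤s (s≤s z≤n)))) ⟩
    1 * ∏ ifPrime (pred (m + m))  ≤⟨ *-mono-≤ (s≤s (z≤n {3})) (rec ≤-refl) ⟩
    4 ^ (m + m)                   ∎
  ... | 0 , inj₂ refl = ≤ᵇ⇒≤ (∏ ifPrime 1) 4 tt
  ... | m@(suc k) , inj₂ refl = begin
    ∏ ifPrime (suc m + m)
      ≡⟨ ∏-+ ifPrime (suc m) m ⟩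
    ∏ ifPrime (suc m) * ∏ (ifPrime ∘ (suc m +_)) m
      ≤⟨ *-mono-≤ (rec (s≤s (m<m+n m (s≤s z≤n)))) (≤-trans (∏ifPrime≤C (suc m) m (n≤1+n m)) ([2n+1]C[n+1]≤4^n m)) ⟩
    4 ^ suc m * 4 ^ m
      ≡⟨ ^-distribˡ-+-* 4 (suc m) m ⟨
    4 ^ (suc m + m) ∎

-- The case n + 1 = p works because p divides C(2p - 2, p - 1) exactly once.
prime∤centralBinomial : ∀ {p} → Prime p → 2 < p → ∀ j → j + j < p → p ∤ centralBinomial (p + j)
prime∤centralBinomial {p@(suc n)} pp 2<p zero _ p∣ =
  <⇒≱ p²>2n+1 (power∣nCk⇒≤ pp {2} (m≤m+n n n)
    (p²∣ (subst (λ x → p ∣ centralBinomial x) (+-identityʳ p) p∣)))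
  where
  p∤2 : p ∤ 2
  p∤2 = >⇒∤ 2<p
  p∤2n+1 : p ∤ suc (n + n)
  p∤2n+1 p∣ = contradiction (∣m+n∣m⇒∣n {m = p} p∣ ∣-refl)
    (>⇒∤ {{>-nonZero (s≤s⁻¹ (<-trans (s≤s (s≤s z≤n)) 2<p))}} ≤-refl)
  p²∣ : p ∣ centralBinomial p → p ^ 2 ∣ centralBinomial n
  p²∣ p∣@(divides q eq) with euclidsLemma _ (centralBinomial n) pp
      (subst (p ∣_) ([n+1]*centralBinomial n) (m∣m*n (centralBinomial p)))
  ... | inj₁ p∣2[2n+1] = contradiction p∣2[2n+1] (prime∤* pp p∤2 p∤2n+1)
  ... | inj₂ (divides r eq′) = subst (p ^ 2 ∣_) (sym eq′)
    (subst (λ x → p * x ∣ r * p) (sym (*-identityʳ p)) (*-monoˡ-∣ p p∣r))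
    where
    -- Cancelling p from p C(2p, p) = 2 (2n + 1) C(2n, n), where C(2n, n) = r p, leaves C(2p, p) = 2
    -- (2n + 1) r. So p divides r, a second factor p of C(2n, n).
    p∣2[2n+1]r : p ∣ 2 * suc (n + n) * r
    p∣2[2n+1]r = subst (p ∣_) (*-cancelʳ-≡ _ _ p (trans (*-comm (centralBinomial p) p)
      (trans ([n+1]*centralBinomial n) (trans (cong (2 * suc (n + n) *_) eq′)
        (sym (*-assoc (2 * suc (n + n)) r p)))))) p∣
    p∣r : p ∣ r
    p∣r = [ (λ d → contradiction d (prime∤* pp p∤2 p∤2n+1)) , id ]′ (euclidsLemma _ r pp p∣2[2n+1]r)
  p²>2n+1 : suc (n + n) < p ^ 2
  p²>2n+1 = begin-strict
    suc (n + n)     <⟨ s≤s (≤-reflexive (sym (+-suc n n))) ⟩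
    p + p           ≡⟨ cong (p +_) (+-identityʳ p) ⟨
    2 * p           ≤⟨ *-monoˡ-≤ p (<⇒≤ 2<p) ⟩
    p * p           ≡⟨ cong (p *_) (*-identityʳ p) ⟨
    p ^ 2           ∎
    where open ≤-Reasoning
-- From n = p + j to n + 1 the recurrence brings in 2 (2 n + 1), and 2 n + 1 = 2 p + (2 j + 1) with
-- 2 j + 1 < p, so no factor p can enter.
prime∤centralBinomial {p} pp 2<p (suc j) j+1+j+1<p p∣ =
  contradiction (subst (p ∣_) ([n+1]*centralBinomial (p + j)) p∣lhs)
    (prime∤* pp (prime∤* pp (>⇒∤ 2<p) p∤odd) (prime∤centralBinomial pp 2<p j j+j<p))
  where
  p∣lhs : p ∣ suc (p + j) * centralBinomial (suc (p + j))
  p∣lhs = ∣n⇒∣m*n (suc (p + j)) (subst (λ x → p ∣ centralBinomial x) (+-suc p j) p∣)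
  2j+1<p : suc (j + j) < p
  2j+1<p = <-trans (s≤s (≤-reflexive (sym (+-suc j j)))) j+1+j+1<p
  j+j<p : j + j < p
  j+j<p = <-trans (n<1+n (j + j)) 2j+1<p
  regroup : ∀ p j → suc (p + j + (p + j)) ≡ p + p + suc (j + j)
  regroup = solve-∀
  p∤odd : p ∤ suc (p + j + (p + j))
  p∤odd p∣ = >⇒∤ 2j+1<p (∣m+n∣m⇒∣n (subst (p ∣_) (regroup p j) p∣) (∣m∣n⇒∣m+n ∣-refl ∣-refl))

integerSqrt : ∀ n → ∃[ s ] (s * s ≤ n × n < suc s * suc s)
integerSqrt zero = 0 , z≤n , s≤s z≤n
integerSqrt (suc n) with integerSqrt n
... | s , s²≤n , n<[s+1]² with suc n <? suc s * suc s
...   | yes n+1< = s , m≤n⇒m≤1+n s²≤n , n+1<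
...   | no n+1≮ = suc s , ≮⇒≥ n+1≮ , ≤-<-trans n<[s+1]² (*-mono-< (n<1+n (suc s)) (n<1+n (suc s)))

-- A prime between 27i and 48i

*-^-distrib : ∀ m n o → (m * n) ^ o ≡ m ^ o * n ^ o
*-^-distrib m n zero = refl
*-^-distrib m n (suc o) rewrite *-^-distrib m n o = regroup m n (m ^ o) (n ^ o)
  where
  regroup : ∀ m n x y → m * n * (x * y) ≡ m * x * (n * y)
  regroup = solve-∀

^-*-^ : ∀ a b m n o → (a ^ m * b ^ n) ^ o ≡ a ^ (m * o) * b ^ (n * o)
^-*-^ a b m n o = trans (*-^-distrib (a ^ m) (b ^ n) o) (cong₂ _*_ (^-*-assoc a m o) (^-*-assoc b n o))

^-ratio : ∀ {a b c x y} m → 0 < b → x * b ≤ a * y → a ^ m ≤ c * b ^ m → x ^ m ≤ c * y ^ m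
^-ratio {a} {b@(suc _)} {c} {x} {y} m _ xb≤ay a^m≤ = *-cancelʳ-≤ _ _ (b ^ m) (begin
  x ^ m * b ^ m        ≡⟨ *-^-distrib x b m ⟨
  (x * b) ^ m          ≤⟨ ^-monoˡ-≤ m xb≤ay ⟩
  (a * y) ^ m          ≡⟨ *-^-distrib a y m ⟩
  a ^ m * y ^ m        ≤⟨ *-monoˡ-≤ (y ^ m) a^m≤ ⟩
  c * b ^ m * y ^ m    ≡⟨ regroup c (b ^ m) (y ^ m) ⟩
  c * y ^ m * b ^ m    ∎)
  where
  open ≤-Reasoning
  instance _ = m^n≢0 b m
  regroup : ∀ c u v → c * u * v ≡ c * v * u
  regroup = solve-∀

^-cancel : ∀ {a c K X} i → 0 < K → c * K ≤ a → a ^ i ≤ X * K ^ i → c ^ i ≤ X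
^-cancel {a} {c} {K@(suc _)} {X} i _ cK≤a a^i≤ = *-cancelʳ-≤ _ _ (K ^ i) (begin
  c ^ i * K ^ i  ≡⟨ *-^-distrib c K i ⟨
  (c * K) ^ i    ≤⟨ ^-monoˡ-≤ i cK≤a ⟩
  a ^ i          ≤⟨ a^i≤ ⟩
  X * K ^ i      ∎)
  where
  open ≤-Reasoning
  instance _ = m^n≢0 K i

-- Induction from s = b + 1: each step multiplies the left side by ((s + 2) / (s + 1))^m, which is
-- largest at the start, and there it is at most 5.
[s+1]^m≤5^[s-1] : ∀ m b → (2 + b) ^ m ≤ 5 ^ b → (3 + b) ^ m ≤ 5 * (2 + b) ^ m →
  ∀ {s} → suc b ≤ s → suc s ^ m ≤ 5 ^ pred s
[s+1]^m≤5^[s-1] m b base ratio {s} b<s with m≤n⇒∃[o]m+o≡n b<s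
... | v , refl = go v
  where
  open ≤-Reasoning
  expand : ∀ b v → (3 + b + v) * (2 + b) + v ≡ (3 + b) * (2 + b + v)
  expand = solve-∀
  step : ∀ v → (3 + b + v) * (2 + b) ≤ (3 + b) * (2 + b + v)
  step v = subst ((3 + b + v) * (2 + b) ≤_) (expand b v) (m≤m+n _ v)
  go : ∀ v → (2 + b + v) ^ m ≤ 5 ^ (b + v)
  go zero rewrite +-identityʳ b = base
  go (suc v) = begin
    (2 + b + suc v) ^ m    ≡⟨ cong (λ x → (2 + x) ^ m) (+-suc b v) ⟩
    (3 + b + v) ^ m        ≤⟨ ^-ratio {3 + b} {2 + b} {5} {3 + b + v} {2 + b + v} m (s≤s z≤n) (step v) ratio ⟩
    5 * (2 + b + v) ^ m    ≤⟨ *-monoʳ-≤ 5 (go v) ⟩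
    5 ^ suc (b + v)        ≡⟨ cong (5 ^_) (+-suc b v) ⟨
    5 ^ (b + suc v)        ∎

^-cancelˡ-< : ∀ {x y} m → x ^ m < y ^ m → x < y
^-cancelˡ-< m x^m<y^m = ≰⇒> λ y≤x → <⇒≱ x^m<y^m (^-monoˡ-≤ m y≤x)

[s+1]^96≤5^[s-1] : ∀ {s} → 399 ≤ s → suc s ^ (2 * 48) ≤ 5 ^ pred s
[s+1]^96≤5^[s-1] = [s+1]^m≤5^[s-1] (2 * 48) 398
  (≤ᵇ⇒≤ (400 ^ (2 * 48)) (5 ^ 398) tt) (≤ᵇ⇒≤ (401 ^ (2 * 48)) (5 * 400 ^ (2 * 48)) tt)

-- The left side is below (s + 1)^(2 e (s + 1)) ≤ 5^((s - 1)(s + 1)), and (s - 1)(s + 1) = s² - 1 ≤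
-- Y. It is used with e = 48 and Y = 48 i, whence the exponent 96 = 2 · 48.
[N^[s+1]]^e<5^Y : ∀ {N s Y} e → 0 < e → s * s ≤ suc Y → N < suc s * suc s →
  suc s ^ (2 * e) ≤ 5 ^ pred s → (N ^ suc s) ^ e < 5 ^ Y
[N^[s+1]]^e<5^Y {N} {s} {Y} e@(suc _) _ s²≤ N<r² r^2e≤5^[s-1] = begin-strict
  (N ^ r) ^ e             ≡⟨ ^-*-assoc N r e ⟩
  N ^ (r * e)             <⟨ ^-monoˡ-< (r * e) N<r² ⟩
  (r * r) ^ (r * e)       ≡⟨ cong (λ x → (r * x) ^ (r * e)) (*-identityʳ r) ⟨
  (r ^ 2) ^ (r * e)       ≡⟨ ^-*-assoc r 2 (r * e) ⟩
  r ^ (2 * (r * e))       ≡⟨ cong (r ^_) (regroup r e) ⟩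
  r ^ (2 * e * r)         ≡⟨ ^-*-assoc r (2 * e) r ⟨
  (r ^ (2 * e)) ^ r       ≤⟨ ^-monoˡ-≤ r r^2e≤5^[s-1] ⟩
  (5 ^ pred s) ^ r        ≡⟨ ^-*-assoc 5 (pred s) r ⟩
  5 ^ (pred s * r)        ≤⟨ ^-monoʳ-≤ 5 (product s s²≤) ⟩
  5 ^ Y                   ∎
  where
  open ≤-Reasoning
  r = suc s
  regroup : ∀ r e → 2 * (r * e) ≡ 2 * e * r
  regroup = solve-∀
  product : ∀ s → s * s ≤ suc Y → pred s * suc s ≤ Y
  product zero    _  = z≤n
  product (suc m) m² = s≤s⁻¹ (subst (_≤ suc Y) (square m) m²)
    where
    square : ∀ m → suc m * suc m ≡ suc (m * (2 + m))
    square = solve-∀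

N^[s+1]<5^i : ∀ {N s} i → 399 ≤ s → N < suc s * suc s → s * s ≤ suc (i * 48) → N ^ suc s < 5 ^ i
N^[s+1]<5^i {N} {s} i 399≤s N<[s+1]² s²≤ = ^-cancelˡ-< {N ^ suc s} {5 ^ i} 48
  (subst ((N ^ suc s) ^ 48 <_) (sym (^-*-assoc 5 i 48))
    ([N^[s+1]]^e<5^Y {N} {s} {i * 48} 48 (s≤s z≤n) s²≤ N<[s+1]² ([s+1]^96≤5^[s-1] {s} 399≤s)))

-- C(48i, 24i) is at least 4^(24i) / (48i + 1).  If (27i, 48i] contains no prime, then its
-- prime factors are in (24i, 27i], where their product is at most C(27i, 24i), or at most
-- 16i, since those in (16i, 24i] cancel; and each one above S = ⌊√(48i + 1)⌋ occurs once.
module NoPrime (i S : ℕ) (0<i : 0 < i) (399≤S : 399 ≤ S)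
  (S²≤N : S * S ≤ suc (24 * i + 24 * i)) (N<[S+1]² : suc (24 * i + 24 * i) < suc S * suc S)
  (none : ∀ {p} → Prime p → 24 * i + 3 * i < p → p ≤ 24 * i + 24 * i → ⊥)
  where
  open ≤-Reasoning

  private
    n N B : ℕ
    n = 24 * i
    N = suc (n + n)
    B = centralBinomial n

  0<B : 0 < B
  0<B = nCk>0 (m≤m+n n n)

  B∣[2n]! : B ∣ (n + n) !
  B∣[2n]! = subst (B ∣_) (nCk*k!*[n∸k]!≡n! (m≤m+n n n)) (m∣m*n _)

  smooth : PrimesUpTo (n + 3 * i) B
  smooth {p} pp p∣B with p ≤? n + 3 * i
  ... | yes p≤ = p≤
  ... | no p≰ = contradiction (prime∣!⇒≤ pp (n + n) (∣-trans p∣B B∣[2n]!)) (λ p≤ → none pp (≰⇒> p≰) p≤)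

  large : ∀ {p} e → S < p → Prime p → p ^ e ∣ B → p ^ e ≤ ifPrime p
  large {p} zero S<p pp _ = ifPrime>0 p
  large {p} (suc zero) S<p pp _ = ≤-reflexive (trans (*-identityʳ p) (sym (ifPrime-prime pp)))
  large {p} (suc (suc e)) S<p pp d = contradiction
    (≤-trans p²≤p^e (power∣nCk⇒≤ pp {2 + e} (m≤m+n n n) d))
    (<⇒≱ (<-≤-trans N<[S+1]² (*-mono-≤ S<p S<p)))
    where
    instance _ = prime⇒nonZero pp
    p²≤p^e : p * p ≤ p ^ (2 + e)
    p²≤p^e = *-monoʳ-≤ p (m≤m*n p (p ^ e) {{m^n≢0 p e}})

  4S≤N : 4 * S ≤ N
  4S≤N = ≤-trans (*-monoˡ-≤ S (≤-trans (m≤m+n 4 395) 399≤S)) S²≤N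

  S≤16i : S ≤ 16 * i
  S≤16i = ≮⇒≥ λ 16i<S → <⇒≱ (begin-strict
    N                     <⟨ m<m+n N {16 * i + 3} 0<16i+3 ⟩
    N + (16 * i + 3)      ≡⟨ regroup i ⟩
    4 * suc (16 * i)      ∎) (≤-trans (*-monoʳ-≤ 4 16i<S) 4S≤N)
    where
    regroup : ∀ i → suc (24 * i + 24 * i) + (16 * i + 3) ≡ 4 * suc (16 * i)
    regroup = solve-∀
    0<16i+3 : 0 < 16 * i + 3
    0<16i+3 = subst (0 <_) (+-comm 3 (16 * i)) (s≤s z≤n)

  -- For n = p + j, the inequality 3 p > 48 i = 2 n says exactly that 2 j < p.
  middle : ∀ {p} → Prime p → p ≤ n → 16 * i < p → p ∤ B
  middle {p} pp p≤n 16i<p p∣B = prime∤centralBinomial pp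
    (<-≤-trans (s≤s (s≤s (s≤s z≤n))) (≤-trans (≤-trans (m≤m+n 3 396) 399≤S) (≤-trans S≤16i (<⇒≤ 16i<p))))
    (n ∸ p) 2j<p (subst (λ x → p ∣ centralBinomial x) (sym p+j) p∣B)
    where
    p+j : p + (n ∸ p) ≡ n
    p+j = m+[n∸m]≡n p≤n
    2j<p : (n ∸ p) + (n ∸ p) < p
    2j<p = +-cancelˡ-< (p + p) _ _ (begin-strict
      p + p + ((n ∸ p) + (n ∸ p))      ≡⟨ regroup p (n ∸ p) ⟩
      (p + (n ∸ p)) + (p + (n ∸ p))    ≡⟨ cong₂ _+_ p+j p+j ⟩
      n + n                            ≡⟨ regroup₂ i ⟩
      16 * i + 16 * i + 16 * i         <⟨ +-mono-< (+-mono-< 16i<p 16i<p) 16i<p ⟩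
      p + p + p                        ∎)
      where
      regroup : ∀ p j → p + p + (j + j) ≡ (p + j) + (p + j)
      regroup = solve-∀
      regroup₂ : ∀ i → 24 * i + 24 * i ≡ 16 * i + 16 * i + 16 * i
      regroup₂ = solve-∀

  noPrimes⇒≤1 : ∀ {m} → PrimesUpTo 0 m → m ≤ 1
  noPrimes⇒≤1 {m} sm = ≮⇒≥ λ 1<m → let p , pp , p∣m = hasPrimeDivisor m 1<m in
    contradiction (sm pp p∣m) (<⇒≱ (<-trans (s≤s z≤n) (prime>1 pp)))

  divisor>0 : ∀ {m} → m ∣ B → 0 < m
  divisor>0 {zero} 0∣B = contradiction (0∣⇒≡0 0∣B) (m<n⇒n≢0 0<B)
  divisor>0 {suc _} _ = s≤s z≤n

  ∏≤ : ∏ (ifPrime ∘ (S +_)) (16 * i ∸ S) ≤ 4 ^ (16 * i)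
  ∏≤ = begin
    ∏ (ifPrime ∘ (S +_)) (16 * i ∸ S)
      ≤⟨ m≤n*m _ (∏ ifPrime S) {{>-nonZero (∏>0 ifPrime ifPrime>0 S)}} ⟩
    ∏ ifPrime S * ∏ (ifPrime ∘ (S +_)) (16 * i ∸ S)
      ≡⟨ ∏-+ ifPrime S (16 * i ∸ S) ⟨
    ∏ ifPrime (S + (16 * i ∸ S))
      ≡⟨ cong (∏ ifPrime) (m+[n∸m]≡n S≤16i) ⟩
    ∏ ifPrime (16 * i)
      ≤⟨ primorial≤4^n (16 * i) ⟩
    4 ^ (16 * i) ∎

  small≤ : ∀ {m} → m ∣ B → PrimesUpTo S m → m ≤ N ^ S
  small≤ {m} m∣B sm = stripSmall (strip (λ _ → N) 0 S m (divisor>0 m∣B) sm (λ _ → s≤s z≤n)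
      (λ {p} e _ pp d → power∣nCk⇒≤ pp {e} (m≤m+n n n) (∣-trans d m∣B)))
    where
    stripSmall : ∃[ m′ ] (m′ ∣ m × PrimesUpTo 0 m′ × m ≤ m′ * ∏ (λ _ → N) S) → m ≤ N ^ S
    stripSmall (m′ , _ , sm′ , m≤) = begin
      m                      ≤⟨ m≤ ⟩
      m′ * ∏ (λ _ → N) S     ≤⟨ *-mono-≤ (noPrimes⇒≤1 sm′) (≤-reflexive (∏-const N S)) ⟩
      1 * N ^ S              ≡⟨ *-identityˡ (N ^ S) ⟩
      N ^ S                  ∎

  ≤16i : ∀ {m} → m ∣ B → PrimesUpTo n m → m ≤ N ^ S * 4 ^ (16 * i)
  ≤16i {m} m∣B sm = stripMiddle (strip ifPrime S (16 * i ∸ S) m (divisor>0 m∣B) sm₁ ifPrime>0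
      (λ e S<p pp d → large e S<p pp (∣-trans d m∣B)))
    where
    sm₁ : PrimesUpTo (S + (16 * i ∸ S)) m
    sm₁ {p} pp p∣m = subst (p ≤_) (sym (m+[n∸m]≡n S≤16i))
      (≮⇒≥ λ 16i<p → middle pp (sm pp p∣m) 16i<p (∣-trans p∣m m∣B))
    stripMiddle : ∃[ m′ ] (m′ ∣ m × PrimesUpTo S m′ × m ≤ m′ * ∏ (ifPrime ∘ (S +_)) (16 * i ∸ S)) →
                  m ≤ N ^ S * 4 ^ (16 * i)
    stripMiddle (m′ , m′∣m , sm′ , m≤) =
      ≤-trans m≤ (*-mono-≤ (small≤ (∣-trans m′∣m m∣B) sm′) ∏≤)

  stripLarge : ∃[ m ] (m ∣ B × PrimesUpTo n m × B ≤ m * ∏ (ifPrime ∘ (n +_)) (3 * i)) →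
               B ≤ N ^ S * 4 ^ (16 * i) * ((n + 3 * i) C n)
  stripLarge (m , m∣B , sm , B≤m*) =
    ≤-trans B≤m* (*-mono-≤ (≤16i m∣B sm) (∏ifPrime≤C n (3 * i) (*-monoˡ-≤ i (m≤m+n 3 21))))

  S≤n : S ≤ n
  S≤n = ≤-trans S≤16i (*-monoˡ-≤ i (m≤m+n 16 8))

  B≤ : B ≤ N ^ S * 4 ^ (16 * i) * ((n + 3 * i) C n)
  B≤ = stripLarge (strip ifPrime n (3 * i) B 0<B smooth ifPrime>0
      (λ e n<p → large e (≤-<-trans S≤n n<p)))

  -- Per unit of i, the lower bound 4^24 for the central binomial coefficient exceeds the upper
  -- bounds 4^16 and 9^27 / 8^24 together by the factor 2^88 / 3^54 = 5.32..., rounded down to 5.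
  -- The additional factor N comes from 4^n ≤ N B.
  5^i≤N^[S+1] : 5 ^ i ≤ N ^ suc S
  5^i≤N^[S+1] = ^-cancel {4 ^ 24 * 8 ^ 24} {5} {4 ^ 16 * 9 ^ 27} i (≤ᵇ⇒≤ 1 (4 ^ 16 * 9 ^ 27) tt)
    (≤ᵇ⇒≤ (5 * (4 ^ 16 * 9 ^ 27)) (4 ^ 24 * 8 ^ 24) tt) (begin
    (4 ^ 24 * 8 ^ 24) ^ i
      ≡⟨ ^-*-^ 4 8 24 24 i ⟩
    4 ^ n * 8 ^ n
      ≤⟨ *-monoˡ-≤ (8 ^ n) (4^n≤[2n+1]*centralBinomial n) ⟩
    N * B * 8 ^ n
      ≤⟨ *-monoˡ-≤ (8 ^ n) (*-monoʳ-≤ N B≤) ⟩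
    N * (N ^ S * 4 ^ (16 * i) * ((n + 3 * i) C n)) * 8 ^ n
      ≡⟨ regroup N (N ^ S) (4 ^ (16 * i)) ((n + 3 * i) C n) (8 ^ n) ⟩
    N ^ suc S * (4 ^ (16 * i) * (((n + 3 * i) C n) * 8 ^ n))
      ≤⟨ *-monoʳ-≤ (N ^ suc S) (*-monoʳ-≤ (4 ^ (16 * i)) (nCk*m^k≤[m+1]^n 8 (n + 3 * i) n)) ⟩
    N ^ suc S * (4 ^ (16 * i) * 9 ^ (n + 3 * i))
      ≡⟨ cong (λ x → N ^ suc S * (4 ^ (16 * i) * 9 ^ x)) (*-distribʳ-+ i 24 3) ⟨
    N ^ suc S * (4 ^ (16 * i) * 9 ^ (27 * i))
      ≡⟨ cong (N ^ suc S *_) (^-*-^ 4 9 16 27 i) ⟨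
    N ^ suc S * (4 ^ 16 * 9 ^ 27) ^ i ∎)
    where
    regroup : ∀ N x y z w → N * (x * y * z) * w ≡ N * x * (y * (z * w))
    regroup = solve-∀

  impossible : ⊥
  impossible = <⇒≱ (N^[s+1]<5^i {N} {S} i 399≤S N<[S+1]² (subst (λ Y → S * S ≤ suc Y) (48i i) S²≤N)) 5^i≤N^[S+1]
    where
    48i : ∀ i → 24 * i + 24 * i ≡ i * 48
    48i = solve-∀

-- Without such a prime, 5^i would be at most the subexponential N^(S + 1). As 48 · 3400 ≥ 399², the
-- root S is in the range where this is refuted.
Prime∈⟨27i,48i] : ∀ i → 3400 ≤ i → ∃[ p ] (Prime p × 27 * i < p × p ≤ 48 * i)
Prime∈⟨27i,48i] i 3400≤i with integerSqrt (suc (24 * i + 24 * i))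
... | S , S²≤N , N<[S+1]²
  with anyUpTo? (λ p → prime? p ×-dec 27 * i <? p) (suc (48 * i))
... | yes (p , s≤s p≤ , pp , <p) = p , pp , <p , p≤
... | no none = ⊥-elim (NoPrime.impossible i S (≤-trans (s≤s z≤n) 3400≤i) 399≤S S²≤N N<[S+1]²
  λ {p} pp <p p≤ → none (p , s≤s (subst (p ≤_) (sym (*-distribʳ-+ i 24 24)) p≤)
    , pp , subst (_< p) (sym (*-distribʳ-+ i 24 3)) <p))
  where
  399≤S : 399 ≤ S
  399≤S = ≮⇒≥ λ S<399 → <⇒≱ N<[S+1]² (begin
    suc S * suc S                ≤⟨ *-mono-≤ S<399 S<399 ⟩
    399 * 399                    ≤⟨ ≤ᵇ⇒≤ (399 * 399) (48 * 3400) tt ⟩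
    48 * 3400                    ≤⟨ *-monoʳ-≤ 48 3400≤i ⟩
    48 * i                       ≡⟨ *-distribʳ-+ i 24 24 ⟩
    24 * i + 24 * i              ≤⟨ n≤1+n _ ⟩
    suc (24 * i + 24 * i)        ∎)
    where open ≤-Reasoning

-- A prime shortly after every x ≥ 28

-- Trial division by 2, ..., m + 1, to be run by evaluation; if n < (m + 2)², success certifies that
-- n > 1 is prime.
rough? : ∀ m n → Dec ((2 + m) Rough n)
rough? zero    n = yes 2-rough
rough? (suc m) n = map′ (λ (2+m∤n , r) → ∤⇒rough-suc 2+m∤n r)
  (λ r → (λ 2+m∣n → r (hasNonTrivialDivisor ≤-refl 2+m∣n))
       , (λ (hasNonTrivialDivisor d< d∣n) → r (hasNonTrivialDivisor (m<n⇒m<1+n d<) d∣n)))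
  (¬? (2 + m ∣? n) ×-dec rough? m n)

-- q < √3.2 x
PrimeShortlyAfter : ℕ → Set
PrimeShortlyAfter x = ∃[ q ] (Prime q × x < q × 5 * (q * q) ≤ 16 * (x * x))

-- The single prime q serves all x in [a, q), since q ≤ √3.2 a ≤ √3.2 x; from q on, `later` takes
-- over. The implicit arguments are numerical checks settled by evaluation.
primeStep : ∀ a m q {_ : True (rough? m q)} {_ : True (1 <? q)} {_ : True (q <? (2 + m) * (2 + m))}
  {_ : True (5 * (q * q) ≤? 16 * (a * a))} →
  (∀ x → q ≤ x → PrimeShortlyAfter x) → ∀ x → a ≤ x → PrimeShortlyAfter x
primeStep a m q {r} {1<q} {q<} {≤a} later x a≤x with q ≤? x
... | yes q≤x = later x q≤x
... | no q≰x = q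
  , rough∧square>⇒prime {{n>1⇒nonTrivial (toWitness {a? = 1 <? q} 1<q)}}
      (toWitness {a? = rough? m q} r) (toWitness {a? = q <? (2 + m) * (2 + m)} q<)
  , ≰⇒> q≰x , ≤-trans (toWitness {a? = 5 * (q * q) ≤? 16 * (a * a)} ≤a) (*-monoʳ-≤ 16 (*-mono-≤ a≤x a≤x))

square-ratio : ∀ {K L a x} c d → 0 < c → K * (d * d) ≤ L * (c * c) → c * a ≤ d * x →
  K * (a * a) ≤ L * (x * x)
square-ratio {K} {L} {a} {x} c@(suc _) d _ Kd²≤Lc² ca≤dx = *-cancelˡ-≤ (c * c) (begin
  c * c * (K * (a * a))        ≡⟨ regroup c K a ⟩
  K * ((c * a) * (c * a))      ≤⟨ *-monoʳ-≤ K (*-mono-≤ ca≤dx ca≤dx) ⟩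
  K * ((d * x) * (d * x))      ≡⟨ regroup₂ K d x ⟩
  K * (d * d) * (x * x)        ≤⟨ *-monoˡ-≤ (x * x) Kd²≤Lc² ⟩
  L * (c * c) * (x * x)        ≡⟨ regroup₃ L (c * c) (x * x) ⟩
  c * c * (L * (x * x))        ∎)
  where
  open ≤-Reasoning
  regroup : ∀ c K a → c * c * (K * (a * a)) ≡ K * ((c * a) * (c * a))
  regroup = solve-∀
  regroup₂ : ∀ K d x → K * ((d * x) * (d * x)) ≡ K * (d * d) * (x * x)
  regroup₂ = solve-∀
  regroup₃ : ∀ L c x → L * c * x ≡ c * (L * x)
  regroup₃ = solve-∀

*-chain-≤ : ∀ {q i x} a b c d g h → q ≤ b * i → a * b ≡ g * h * c → h * (c * i) ≤ d * x →
  a * q ≤ g * d * x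
*-chain-≤ {q} {i} {x} a b c d g h q≤bi ab≡ghc hci≤dx = begin
  a * q              ≤⟨ *-monoʳ-≤ a q≤bi ⟩
  a * (b * i)        ≡⟨ *-assoc a b i ⟨
  a * b * i          ≡⟨ cong (_* i) ab≡ghc ⟩
  g * h * c * i      ≡⟨ regroup g h c i ⟩
  g * (h * (c * i))  ≤⟨ *-monoʳ-≤ g hci≤dx ⟩
  g * (d * x)        ≡⟨ *-assoc g d x ⟨
  g * d * x          ∎
  where
  open ≤-Reasoning
  regroup : ∀ g h c i → g * h * c * i ≡ g * (h * (c * i))
  regroup = solve-∀

*-absorb : ∀ a b {x} → a * b ≤ x → a * (b + x) ≤ suc a * x
*-absorb a b {x} ab≤x = ≤-trans (≤-reflexive (*-distribˡ-+ a b x)) (+-monoˡ-≤ (a * x) ab≤x)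

primeAfterLarge : ∀ x → 142939 ≤ x → PrimeShortlyAfter x
primeAfterLarge x 142939≤x = fromLarge (Prime∈⟨27i,48i] i (m≤n⇒m≤1+n 3400≤x/27))
  where
  open ≤-Reasoning
  -- 27 i is the first multiple of 27 above x, so 27 i ≤ x + 27 ≤ (201/200) x. Then q ≤ 48 i =
  -- (16/9) 27 i ≤ (16 · 201 / 1800) x, and this ratio has square 3.192... < 3.2.
  i = suc (x / 27)
  3400≤x/27 : 3400 ≤ x / 27
  3400≤x/27 = ≤-trans (≤ᵇ⇒≤ 3400 (142939 / 27) tt) (/-monoˡ-≤ 27 142939≤x)
  27i≡ : 27 * i ≡ 27 + x / 27 * 27
  27i≡ = *-comm 27 i
  x<27i : x < 27 * i
  x<27i = begin-strict
    x                      ≡⟨ m≡m%n+[m/n]*n x 27 ⟩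
    x % 27 + x / 27 * 27   <⟨ +-monoˡ-< (x / 27 * 27) (m%n<n x 27) ⟩
    27 + x / 27 * 27       ≡⟨ 27i≡ ⟨
    27 * i                 ∎
  200*27i≤201x : 200 * (27 * i) ≤ 201 * x
  200*27i≤201x = begin
    200 * (27 * i)               ≡⟨ cong (200 *_) 27i≡ ⟩
    200 * (27 + x / 27 * 27)     ≤⟨ *-monoʳ-≤ 200 (+-monoʳ-≤ 27 (m/n*n≤m x 27)) ⟩
    200 * (27 + x)               ≤⟨ *-absorb 200 27 (≤-trans (≤ᵇ⇒≤ (200 * 27) 142939 tt) 142939≤x) ⟩
    201 * x                      ∎
  fromLarge : ∃[ q ] (Prime q × 27 * i < q × q ≤ 48 * i) → PrimeShortlyAfter x
  fromLarge (q , pq , 27i<q , q≤48i) = q , pq , <-trans x<27i 27i<q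
    , square-ratio {5} {16} {q} {x} 1800 (16 * 201) (s≤s z≤n)
        (≤ᵇ⇒≤ (5 * ((16 * 201) * (16 * 201))) (16 * (1800 * 1800)) tt)
        (*-chain-≤ {q} {i} {x} 1800 48 27 201 16 200 q≤48i refl 200*27i≤201x)

primeShortlyAfter : ∀ x → 28 ≤ x → PrimeShortlyAfter x
primeShortlyAfter =
  primeStep 28 8 47 (primeStep 47 8 83 (primeStep 83 11 139 (primeStep 139 15 241 (primeStep 241 20 431
    (primeStep 431 27 769 (primeStep 769 37 1373 (primeStep 1373 49 2447 (primeStep 2447 66 4373
    (primeStep 4373 88 7817 (primeStep 7817 118 13967 (primeStep 13967 158 24979
    (primeStep 24979 211 44683 (primeStep 44683 282 79907 (primeStep 79907 378 142939
    primeAfterLarge))))))))))))))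

primeAboveSqrt : ∀ t → 811 ≤ t → ∃[ q ] (Prime q × t ≤ q * q × 5 * (q * q) ≤ 16 * t)
primeAboveSqrt t 811≤t = fromSqrt (integerSqrt t)
  where
  fromSqrt : ∃[ s ] (s * s ≤ t × t < suc s * suc s) →
             ∃[ q ] (Prime q × t ≤ q * q × 5 * (q * q) ≤ 16 * t)
  fromSqrt (s , s²≤t , t<[s+1]²) = fromPrime (primeShortlyAfter s 28≤s)
    where
    28≤s : 28 ≤ s
    28≤s = ≮⇒≥ λ s<28 → <⇒≱ t<[s+1]²
      (≤-trans (*-mono-≤ s<28 s<28) (≤-trans (≤ᵇ⇒≤ (28 * 28) 811 tt) 811≤t))
    fromPrime : PrimeShortlyAfter s → ∃[ q ] (Prime q × t ≤ q * q × 5 * (q * q) ≤ 16 * t)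
    fromPrime (q , pq , s<q , 5q²≤16s²) = q , pq
      , ≤-trans (<⇒≤ t<[s+1]²) (*-mono-≤ s<q s<q) , ≤-trans 5q²≤16s² (*-monoʳ-≤ 16 s²≤t)

-- Sums and counting

sum-mono-≤ : ∀ {n} {f g : Fin n → ℕ} → (∀ i → f i ≤ g i) → sum f ≤ sum g
sum-mono-≤ {zero}  f≤g = z≤n
sum-mono-≤ {suc n} f≤g = +-mono-≤ (f≤g zero) (sum-mono-≤ (f≤g ∘ suc))

sum-mono-< : ∀ {n} {f g : Fin n → ℕ} → (∀ i → f i ≤ g i) → ∀ i → f i < g i → sum f < sum g
sum-mono-< f≤g zero    f<g = +-mono-<-≤ f<g (sum-mono-≤ (f≤g ∘ suc))
sum-mono-< f≤g (suc i) f<g = +-mono-≤-< (f≤g zero) (sum-mono-< (f≤g ∘ suc) i f<g)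

sum-const : ∀ n x → ∑[ i < n ] x ≡ n * x
sum-const zero    x = refl
sum-const (suc n) x = cong (x +_) (sum-const n x)

⟦_⟧ : {P : Set} → Dec P → ℕ
⟦ P? ⟧ = if does P? then 1 else 0

⟦⟧-mono-≤ : {P Q : Set} (P? : Dec P) (Q? : Dec Q) → (P → Q) → ⟦ P? ⟧ ≤ ⟦ Q? ⟧
⟦⟧-mono-≤ (no _)  _       _ = z≤n
⟦⟧-mono-≤ (yes p) (yes q) _ = ≤-refl
⟦⟧-mono-≤ (yes p) (no ¬q) f = contradiction (f p) ¬q

⟦⟧-mono-< : {P Q : Set} (P? : Dec P) (Q? : Dec Q) → ¬ P → Q → ⟦ P? ⟧ < ⟦ Q? ⟧
⟦⟧-mono-< (yes p) _       ¬p _ = contradiction p ¬p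
⟦⟧-mono-< (no _)  (yes _) _  _ = ≤-refl
⟦⟧-mono-< (no _)  (no ¬q) _  q = contradiction q ¬q

⟦⟧≡0 : {P : Set} (P? : Dec P) → ¬ P → ⟦ P? ⟧ ≡ 0
⟦⟧≡0 (yes p) ¬p = contradiction p ¬p
⟦⟧≡0 (no _)  _  = refl

⟦⟧≤1 : {P : Set} (P? : Dec P) → ⟦ P? ⟧ ≤ 1
⟦⟧≤1 (yes _) = ≤-refl
⟦⟧≤1 (no _)  = z≤n

∑⟦i≟⟧≡1 : ∀ {n} (i : Fin n) → ∑[ j < n ] ⟦ i ≟ᶠ j ⟧ ≡ 1
∑⟦i≟⟧≡1 {suc n} zero    = cong suc (sum-replicate-zero n)
∑⟦i≟⟧≡1 {suc n} (suc i) = ∑⟦i≟⟧≡1 i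

∑⟦l<a∸h*s⟧≡0 : ∀ n {l a} s → a ≤ l → ∑[ h < n ] ⟦ l <? a ∸ toℕ h * s ⟧ ≡ 0
∑⟦l<a∸h*s⟧≡0 n {l} {a} s a≤l = trans
  (sum-cong-≗ {n} (λ h → ⟦⟧≡0 (l <? a ∸ toℕ h * s) (≤⇒≯ (≤-trans (m∸n≤m a (toℕ h * s)) a≤l))))
  (sum-replicate-zero n)

-- With s = w + 1, a class of a vertices has ⌈(a - l) / s⌉ parts with more than l vertices; as l ≤
-- w, part h is one of them exactly when a - h s > l. The recursion takes off one part at a time.
∑⟦l<a∸h*s⟧*s≤ : ∀ n {l w} a → l ≤ w →
  (∑[ h < n ] ⟦ l <? a ∸ toℕ h * suc w ⟧) * suc w ≤ a + (w ∸ l)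
∑⟦l<a∸h*s⟧*s≤ zero a _ = z≤n
∑⟦l<a∸h*s⟧*s≤ (suc n) {l} {w} a l≤w with a ≤? l
... | yes a≤l = subst (λ x → x * suc w ≤ a + (w ∸ l)) (sym (∑⟦l<a∸h*s⟧≡0 (suc n) (suc w) a≤l)) z≤n
... | no a≰l = begin
  (⟦ l <? a ⟧ + ∑[ h < n ] ⟦ l <? a ∸ (s + toℕ h * s) ⟧) * s
    ≡⟨ cong (λ x → (⟦ l <? a ⟧ + x) * s)
         (sum-cong-≗ {n} (λ h → cong (λ x → ⟦ l <? x ⟧) (sym (∸-+-assoc a s (toℕ h * s))))) ⟩
  (⟦ l <? a ⟧ + A) * s
    ≤⟨ *-monoˡ-≤ s (+-monoˡ-≤ A (⟦⟧≤1 (l <? a))) ⟩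
  s + A * s
    ≤⟨ rest ⟩
  a + (w ∸ l) ∎
  where
  open ≤-Reasoning
  s = suc w
  A = ∑[ h < n ] ⟦ l <? (a ∸ s) ∸ toℕ h * s ⟧
  rest : s + A * s ≤ a + (w ∸ l)
  -- If a < s, then `a ∸ s` is truncated and the recursive bound too weak. When no later part
  -- counts, a > l alone gives s ≤ a + (w - l).
  rest with (a ∸ s) ≤? l
  ... | yes a∸s≤l = begin
    s + A * s        ≡⟨ cong (λ x → s + x * s) (∑⟦l<a∸h*s⟧≡0 n s a∸s≤l) ⟩
    s + 0            ≡⟨ +-identityʳ s ⟩
    suc w            ≡⟨ cong suc (m+[n∸m]≡n l≤w) ⟨
    suc l + (w ∸ l)  ≤⟨ +-monoˡ-≤ (w ∸ l) (≰⇒> a≰l) ⟩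
    a + (w ∸ l)      ∎
  ... | no a∸s≰l = begin
    s + A * s                ≤⟨ +-monoʳ-≤ s (∑⟦l<a∸h*s⟧*s≤ n (a ∸ s) l≤w) ⟩
    s + ((a ∸ s) + (w ∸ l))  ≡⟨ +-assoc s (a ∸ s) (w ∸ l) ⟨
    s + (a ∸ s) + (w ∸ l)    ≡⟨ cong (_+ (w ∸ l)) (m+[n∸m]≡n s≤a) ⟩
    a + (w ∸ l)              ∎
    where
    s≤a : s ≤ a
    s≤a = <⇒≤ (m∸n≢0⇒n<m (λ eq → a∸s≰l (subst (_≤ l) (sym eq) z≤n)))

-- Laying out the colour classes

-- Every colour class is cut into parts of s = w + 1 consecutive vertices, the last
-- one possibly smaller.  The parts are numbered by decreasing size: the column of
-- a vertex is the number of its part, its level the position inside the part.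
module Layout {n k : ℕ} (c : Fin n → Fin k) (w : ℕ) where

  s : ℕ
  s = suc w

  index : Fin n → ℕ
  index v = ∑[ u < n ] ⟦ (c u ≟ᶠ c v) ×-dec (toℕ u <? toℕ v) ⟧

  size : Fin k → ℕ
  size d = ∑[ u < n ] ⟦ c u ≟ᶠ d ⟧

  level part : Fin n → ℕ
  level v = index v % s
  part v = index v / s

  -- Ties between parts of equal size are broken by colour.
  key : Fin k → ℕ → ℕ
  key d h = (size d ∸ h * s) * k + toℕ d

  -- The weight `size d ∸ h * s` inside `key` counts the vertices of class d from part h on. Not
  -- being capped at s, it respects the order by size and also tells apart the full parts of one
  -- class. Empty parts have weight 0 and precede no nonempty one.
  column : Fin n → ℕ
  column v = ∑[ d < k ] ∑[ h < n ] ⟦ key (c v) (part v) <? key d (toℕ h) ⟧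

  columns : ℕ → ℕ
  columns l = ∑[ d < k ] ∑[ h < n ] ⟦ l <? size d ∸ toℕ h * s ⟧

  index<size : ∀ v → index v < size (c v)
  index<size v = sum-mono-< {n}
    (λ u → ⟦⟧-mono-≤ ((c u ≟ᶠ c v) ×-dec (toℕ u <? toℕ v)) (c u ≟ᶠ c v) proj₁) v
    (⟦⟧-mono-< ((c v ≟ᶠ c v) ×-dec (toℕ v <? toℕ v)) (c v ≟ᶠ c v) (λ (_ , v<v) → <-irrefl refl v<v) refl)

  index-mono-< : ∀ {u v} → c u ≡ c v → toℕ u < toℕ v → index u < index v
  index-mono-< {u} {v} cu≡cv u<v = sum-mono-< {n}
    (λ x → ⟦⟧-mono-≤ ((c x ≟ᶠ c u) ×-dec (toℕ x <? toℕ u)) ((c x ≟ᶠ c v) ×-dec (toℕ x <? toℕ v))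
             (λ (cx≡cu , x<u) → trans cx≡cu cu≡cv , <-trans x<u u<v)) u
    (⟦⟧-mono-< ((c u ≟ᶠ c u) ×-dec (toℕ u <? toℕ u)) ((c u ≟ᶠ c v) ×-dec (toℕ u <? toℕ v))
             (λ (_ , u<u) → <-irrefl refl u<u) (cu≡cv , u<v))

  index-injective : ∀ {u v} → c u ≡ c v → index u ≡ index v → u ≡ v
  index-injective {u} {v} cu≡cv eq with <-cmp (toℕ u) (toℕ v)
  ... | tri< u<v _ _ = contradiction eq (<⇒≢ (index-mono-< cu≡cv u<v))
  ... | tri≈ _ u≡v _ = toℕ-injective u≡v
  ... | tri> _ _ v<u = contradiction (sym eq) (<⇒≢ (index-mono-< (sym cu≡cv) v<u))

  ∑size≡n : ∑[ d < k ] size d ≡ n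
  ∑size≡n = begin
    ∑[ d < k ] ∑[ u < n ] ⟦ c u ≟ᶠ d ⟧  ≡⟨ ∑-comm {k} {n} (λ d u → ⟦ c u ≟ᶠ d ⟧) ⟩
    ∑[ u < n ] ∑[ d < k ] ⟦ c u ≟ᶠ d ⟧  ≡⟨ sum-cong-≗ {n} (λ u → ∑⟦i≟⟧≡1 (c u)) ⟩
    ∑[ u < n ] 1                        ≡⟨ sum-const n 1 ⟩
    n * 1                               ≡⟨ *-identityʳ n ⟩
    n                                   ∎
    where open ≡-Reasoning

  columns*s≤ : ∀ l → l ≤ w → columns l * s ≤ n + k * (w ∸ l)
  columns*s≤ l l≤w = begin
    columns l * s
      ≡⟨ *-distribʳ-sum {k} s (λ d → ∑[ h < n ] ⟦ l <? size d ∸ toℕ h * s ⟧) ⟩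
    ∑[ d < k ] ((∑[ h < n ] ⟦ l <? size d ∸ toℕ h * s ⟧) * s)
      ≤⟨ sum-mono-≤ {k} (λ d → ∑⟦l<a∸h*s⟧*s≤ n (size d) l≤w) ⟩
    ∑[ d < k ] (size d + (w ∸ l))
      ≡⟨ ∑-distrib-+ {k} size (λ _ → w ∸ l) ⟩
    ∑[ d < k ] size d + ∑[ d < k ] (w ∸ l)
      ≡⟨ cong₂ _+_ ∑size≡n (sum-const k (w ∸ l)) ⟩
    n + k * (w ∸ l) ∎
    where open ≤-Reasoning

  index≡ : ∀ v → index v ≡ level v + part v * s
  index≡ v = m≡m%n+[m/n]*n (index v) s

  part*s≤size : ∀ v → part v * s ≤ size (c v)
  part*s≤size v = ≤-trans (≤-trans (m≤n+m _ (level v)) (≤-reflexive (sym (index≡ v)))) (<⇒≤ (index<size v))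

  level<weight : ∀ v → level v < size (c v) ∸ part v * s
  level<weight v = m+n≤o⇒m≤o∸n (suc (level v)) (subst (_< size (c v)) (index≡ v) (index<size v))

  part<n : ∀ v → part v < n
  part<n v = ≤-<-trans (m/n≤m (index v) s) (<-≤-trans (index<size v)
    (≤-trans (sum-mono-≤ {n} (λ u → ⟦⟧≤1 (c u ≟ᶠ c v))) (≤-reflexive (trans (sum-const n 1) (*-identityʳ n)))))

  ∑∑-mono-< : ∀ {P Q : Fin k → ℕ → Set} (P? : ∀ d h → Dec (P d h)) (Q? : ∀ d h → Dec (Q d h)) →
    (∀ d h → P d h → Q d h) → ∀ v → ¬ P (c v) (part v) → Q (c v) (part v) →
    ∑[ d < k ] ∑[ h < n ] ⟦ P? d (toℕ h) ⟧ < ∑[ d < k ] ∑[ h < n ] ⟦ Q? d (toℕ h) ⟧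
  ∑∑-mono-< {P} {Q} P? Q? P⇒Q v ¬p q = sum-mono-< {k}
    (λ d → sum-mono-≤ {n} (mono d)) (c v)
    (sum-mono-< {n} (mono (c v)) h
      (⟦⟧-mono-< (P? (c v) (toℕ h)) (Q? (c v) (toℕ h)) (subst (λ x → ¬ P (c v) x) (sym h≡) ¬p)
        (subst (Q (c v)) (sym h≡) q)))
    where
    h = fromℕ< (part<n v)
    h≡ : toℕ h ≡ part v
    h≡ = toℕ-fromℕ< (part<n v)
    mono : ∀ d h → ⟦ P? d (toℕ h) ⟧ ≤ ⟦ Q? d (toℕ h) ⟧
    mono d h = ⟦⟧-mono-≤ (P? d (toℕ h)) (Q? d (toℕ h)) (P⇒Q d (toℕ h))

  key<⇒weight≤ : ∀ d h d′ h′ → key d h < key d′ h′ → size d ∸ h * s ≤ size d′ ∸ h′ * s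
  key<⇒weight≤ d h d′ h′ lt = ≮⇒≥ λ W′<W → <⇒≱ lt (begin
    W′ * k + toℕ d′  ≤⟨ +-monoʳ-≤ (W′ * k) (<⇒≤ (toℕ<n d′)) ⟩
    W′ * k + k       ≡⟨ +-comm (W′ * k) k ⟩
    suc W′ * k       ≤⟨ *-monoˡ-≤ k W′<W ⟩
    W * k            ≤⟨ m≤m+n (W * k) (toℕ d) ⟩
    key d h          ∎)
    where
    open ≤-Reasoning
    W = size d ∸ h * s
    W′ = size d′ ∸ h′ * s

  -- Every part listed before that of v weighs at least as much, hence also reaches the level of v;
  -- the part of v itself is counted only on the right, which makes the inequality strict.
  column<columns : ∀ v → column v < columns (level v)
  column<columns v = ∑∑-mono-<
    (λ d h → key (c v) (part v) <? key d h) (λ d h → level v <? size d ∸ h * s)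
    (λ d h lt → <-≤-trans (level<weight v) (key<⇒weight≤ (c v) (part v) d h lt))
    v (<-irrefl refl) (level<weight v)

  column-mono-< : ∀ {u v} → key (c u) (part u) < key (c v) (part v) → column v < column u
  column-mono-< {u} {v} lt = ∑∑-mono-<
    (λ d h → key (c v) (part v) <? key d h) (λ d h → key (c u) (part u) <? key d h)
    (λ d h → <-trans lt) v (<-irrefl refl) lt

  column≡⇒key≡ : ∀ {u v} → column u ≡ column v → key (c u) (part u) ≡ key (c v) (part v)
  column≡⇒key≡ {u} {v} eq with <-cmp (key (c u) (part u)) (key (c v) (part v))
  ... | tri< lt _ _ = contradiction (sym eq) (<⇒≢ (column-mono-< lt))
  ... | tri≈ _ eq′ _ = eq′
  ... | tri> _ _ gt = contradiction eq (<⇒≢ (column-mono-< gt))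

  key≡⇒≡ : ∀ d h d′ h′ → key d h ≡ key d′ h′ → d ≡ d′ × size d ∸ h * s ≡ size d′ ∸ h′ * s
  key≡⇒≡ d h d′ h′ eq = toℕ-injective d≡ , *-cancelʳ-≡ W W′ k
    (+-cancelʳ-≡ (toℕ d) _ _ (trans eq (cong (W′ * k +_) (sym d≡))))
    where
    W = size d ∸ h * s
    W′ = size d′ ∸ h′ * s
    instance
      k≢0 : NonZero k
      k≢0 = >-nonZero (≤-<-trans z≤n (toℕ<n d))
    residue : ∀ W (d : Fin k) → (W * k + toℕ d) % k ≡ toℕ d
    residue W d = trans (cong (_% k) (+-comm (W * k) (toℕ d)))
      (trans ([m+kn]%n≡m%n (toℕ d) W k) (m<n⇒m%n≡m (toℕ<n d)))
    d≡ : toℕ d ≡ toℕ d′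
    d≡ = trans (sym (residue W d)) (trans (cong (_% k) eq) (residue W′ d′))

  column≡⇒colour≡ : ∀ {u v} → column u ≡ column v → c u ≡ c v
  column≡⇒colour≡ {u} {v} eq = proj₁ (key≡⇒≡ (c u) (part u) (c v) (part v) (column≡⇒key≡ {u} {v} eq))

  position-injective : ∀ {u v} → column u ≡ column v → level u ≡ level v → u ≡ v
  position-injective {u} {v} eq level≡ = index-injective cu≡cv
    (trans (index≡ u) (trans (cong₂ _+_ level≡ part*s≡) (sym (index≡ v))))
    where
    cu≡cv : c u ≡ c v
    cu≡cv = column≡⇒colour≡ {u} {v} eq
    weight≡ : size (c v) ∸ part u * s ≡ size (c v) ∸ part v * s
    weight≡ = trans (cong (λ d → size d ∸ part u * s) (sym cu≡cv))
      (proj₂ (key≡⇒≡ (c u) (part u) (c v) (part v) (column≡⇒key≡ {u} {v} eq)))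
    part*s≡ : part u * s ≡ part v * s
    part*s≡ = ∸-cancelˡ-≡ (subst (λ d → part u * s ≤ size d) cu≡cv (part*s≤size u)) (part*s≤size v) weight≡

-- Overlaying graphs

offset : ∀ {n} (f : Fin n → ℕ) (i : Fin n) → Fin (f i) → Fin (sum f)
offset f zero    j = j ↑ˡ sum (f ∘ suc)
offset f (suc i) j = f zero ↑ʳ offset (f ∘ suc) i j

↑ˡ≢↑ʳ : ∀ {m n} (i : Fin m) (j : Fin n) → i ↑ˡ n ≢ m ↑ʳ j
↑ˡ≢↑ʳ {m} {n} i j eq with trans (sym (splitAt-↑ˡ m i n)) (trans (cong (splitAt m) eq) (splitAt-↑ʳ m n j))
... | ()

offset-injective : ∀ {n} (f : Fin n → ℕ) i j i′ j′ → offset f i j ≡ offset f i′ j′ →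
  i ≡ i′ × toℕ j ≡ toℕ j′
offset-injective f zero j zero j′ eq = refl , cong toℕ (↑ˡ-injective _ j j′ eq)
offset-injective f zero j (suc i′) j′ eq = contradiction eq (↑ˡ≢↑ʳ j _)
offset-injective f (suc i) j zero j′ eq = contradiction (sym eq) (↑ˡ≢↑ʳ j′ _)
offset-injective f (suc i) j (suc i′) j′ eq
  with offset-injective (f ∘ suc) i j i′ j′ (↑ʳ-injective (f zero) _ _ eq)
... | refl , j≡ = refl , j≡

-- A pair of vertices of U is adjacent when it is the image of an edge of some F i; no
-- other F j may then map a non-edge to it.
module Overlay {t n m : ℕ} (F : Family t n) (φ : Fin t → Fin n → Fin m)
  (φ-injective : ∀ i {u v} → φ i u ≡ φ i v → u ≡ v)
  (φ-disjoint : ∀ {i j u u′ v v′} → i ≢ j → φ i u ≡ φ j u′ → φ i v ≡ φ j v′ → ¬ T (adj (F j) u′ v′))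
  where

  Joined : Fin m → Fin m → Set
  Joined x y = ∃[ i ] ∃[ u ] ∃[ v ] (φ i u ≡ x × φ i v ≡ y × T (adj (F i) u v))

  joined? : ∀ x y → Dec (Joined x y)
  joined? x y = any? λ i → any? λ u → any? λ v →
    (φ i u ≟ᶠ x) ×-dec (φ i v ≟ᶠ y) ×-dec T? (adj (F i) u v)

  joined-sym : ∀ {x y} → Joined x y → Joined y x
  joined-sym (i , u , v , φu , φv , uv) = i , v , u , φv , φu , subst T (symm (F i) u v) uv

  does-cong : {P Q : Set} (P? : Dec P) (Q? : Dec Q) → (P → Q) → (Q → P) → does P? ≡ does Q?
  does-cong (yes p) Q? f g = sym (dec-true Q? (f p))
  does-cong (no ¬p) Q? f g = sym (dec-false Q? (¬p ∘ g))

  overlay : Graph (Fin m)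
  overlay .adj x y    = does (joined? x y)
  overlay .symm x y   = does-cong (joined? x y) (joined? y x) joined-sym joined-sym
  overlay .irrefl x   = dec-false (joined? x x) λ (i , u , v , φu , φv , uv) →
    subst T (irrefl (F i) u) (subst (λ v → T (adj (F i) u v)) (φ-injective i (trans φv (sym φu))) uv)

  joined⇒adj : ∀ i u v → Joined (φ i u) (φ i v) → T (adj (F i) u v)
  joined⇒adj i u v (j , u′ , v′ , φu , φv , uv) with i ≟ᶠ j
  ... | yes refl = subst₂ (λ u v → T (adj (F i) u v)) (φ-injective i φu) (φ-injective i φv) uv
  ... | no i≢j = contradiction uv (φ-disjoint i≢j (sym φu) (sym φv))

  embed : ∀ i → F i ↪ overlay
  embed i = embedding (φ i) (λ _ _ → φ-injective i) λ u v →
    does-cong (T? (adj (F i) u v)) (joined? (φ i u) (φ i v))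
      (λ uv → i , u , v , refl , refl , uv) (joined⇒adj i u v)

  hasInducedUniversal : HasInducedUniversal F m
  hasInducedUniversal = overlay , λ i → ↪⇒≅induced (embed i)

𝒰≤ : ∀ {t n m} {F : Family t n} → HasInducedUniversal F m → 𝒰 F ≤ m
𝒰≤ {F = F} = proj₂ (proj₂ (leastInducedUniversal F)) _

-- Lines over ℤ / q

open import Data.Integer using (+_; 1ℤ; ∣_∣)
  renaming (_+_ to _+ᶻ_; _*_ to _*ᶻ_; _-_ to _-ᶻ_; _≤_ to _≤ᶻ_)

<∧∣-⇒≡ : ∀ {q a b} → a < q → b < q → + q ∣ᶻ + a -ᶻ + b → a ≡ b
<∧∣-⇒≡ {q} {a} {b} a<q b<q d with a ≟ b
... | yes a≡b = a≡b
... | no a≢b = contradiction (prime∣⇒≤ 0<∣a-b∣ (∣⇒∣ᵤ d)) (<⇒≱ ∣a-b∣<q)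
  where
  0<∣a-b∣ : 0 < ∣ + a -ᶻ + b ∣
  0<∣a-b∣ = n≢0⇒n>0 λ eq → a≢b (ℤₚ.+-injective (ℤₚ.i-j≡0⇒i≡j (+ a) (+ b) (ℤₚ.∣i∣≡0⇒i≡0 eq)))
  ∣a-b∣<q : ∣ + a -ᶻ + b ∣ < q
  ∣a-b∣<q = ≤-<-trans (subst (λ i → ∣ i ∣ ≤ a ⊔ b) (sym (ℤₚ.m-n≡m⊖n a b)) (ℤₚ.∣m⊝n∣≤m⊔n a b)) (⊔-lub a<q b<q)

%≡⇒∣- : ∀ m n q .{{_ : NonZero q}} → m % q ≡ n % q → + q ∣ᶻ + m -ᶻ + n
%≡⇒∣- m n q eq = divides (+ (m / q) -ᶻ + (n / q))
  (trans (cong₂ _-ᶻ_ (trans (expand m) (cong (λ r → + r +ᶻ + (m / q) *ᶻ + q) eq)) (expand n))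
    (cancel (+ (n % q)) (+ (m / q)) (+ (n / q)) (+ q)))
  where
  open ≡-Reasoning
  expand : ∀ m → + m ≡ + (m % q) +ᶻ + (m / q) *ᶻ + q
  expand m = begin
    + m                                  ≡⟨ cong +_ (m≡m%n+[m/n]*n m q) ⟩
    + (m % q + m / q * q)                ≡⟨ ℤₚ.pos-+ (m % q) (m / q * q) ⟩
    + (m % q) +ᶻ + (m / q * q)           ≡⟨ cong (+ (m % q) +ᶻ_) (ℤₚ.pos-* (m / q) q) ⟩
    + (m % q) +ᶻ + (m / q) *ᶻ + q        ∎
  cancel : ∀ r a b q → (r +ᶻ a *ᶻ q) -ᶻ (r +ᶻ b *ᶻ q) ≡ (a -ᶻ b) *ᶻ q
  cancel = ℤSolver.solve-∀

module _ {q : ℕ} (pq : Prime q) where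

  private instance
    q≢0 : NonZero q
    q≢0 = prime⇒nonZero pq

  line : ℕ → ℕ → ℕ → ℕ
  line a b x = (a * x + b) % q

  pos-line : ∀ a b x → + (a * x + b) ≡ + a *ᶻ + x +ᶻ + b
  pos-line a b x = trans (ℤₚ.pos-+ (a * x) b) (cong (_+ᶻ + b) (ℤₚ.pos-* a x))

  line≡⇒∣- : ∀ a b a′ b′ x → line a b x ≡ line a′ b′ x →
    + q ∣ᶻ (+ a *ᶻ + x +ᶻ + b) -ᶻ (+ a′ *ᶻ + x +ᶻ + b′)
  line≡⇒∣- a b a′ b′ x eq = subst₂ (λ i j → + q ∣ᶻ i -ᶻ j) (pos-line a b x) (pos-line a′ b′ x)
    (%≡⇒∣- (a * x + b) (a′ * x + b′) q eq)

  -- Subtracting the two congruences leaves q ∣ (a - a′)(x - y), and the prime q does not divide x -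
  -- y. The differences are taken in ℤ.
  line-injective : ∀ {a b a′ b′ x y} → a < q → b < q → a′ < q → b′ < q → x < q → y < q → x ≢ y →
    line a b x ≡ line a′ b′ x → line a b y ≡ line a′ b′ y → a ≡ a′ × b ≡ b′
  line-injective {a} {b} {a′} {b′} {x} {y} a<q b<q a′<q b′<q x<q y<q x≢y eqx eqy = a≡a′ , b≡b′
    where
    slope : ∀ a b a′ b′ x y →
      ((a *ᶻ x +ᶻ b) -ᶻ (a′ *ᶻ x +ᶻ b′)) -ᶻ ((a *ᶻ y +ᶻ b) -ᶻ (a′ *ᶻ y +ᶻ b′)) ≡ (a -ᶻ a′) *ᶻ (x -ᶻ y)
    slope = ℤSolver.solve-∀
    intercept : ∀ a b b′ x → (a *ᶻ x +ᶻ b) -ᶻ (a *ᶻ x +ᶻ b′) ≡ b -ᶻ b′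
    intercept = ℤSolver.solve-∀
    q∣slope : + q ∣ᶻ (+ a -ᶻ + a′) *ᶻ (+ x -ᶻ + y)
    q∣slope = subst (+ q ∣ᶻ_) (slope (+ a) (+ b) (+ a′) (+ b′) (+ x) (+ y))
      (∣m∣n⇒∣m-n (line≡⇒∣- a b a′ b′ x eqx) (line≡⇒∣- a b a′ b′ y eqy))
    a≡a′ : a ≡ a′
    a≡a′ = [ <∧∣-⇒≡ a<q a′<q ∘ ∣ᵤ⇒∣ , (λ q∣x-y → contradiction (<∧∣-⇒≡ x<q y<q (∣ᵤ⇒∣ q∣x-y)) x≢y) ]′
      (euclidsLemma ∣ + a -ᶻ + a′ ∣ ∣ + x -ᶻ + y ∣ pq
        (subst (q ∣_) (ℤₚ.abs-* (+ a -ᶻ + a′) (+ x -ᶻ + y)) (∣⇒∣ᵤ q∣slope)))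
    b≡b′ : b ≡ b′
    b≡b′ = <∧∣-⇒≡ b<q b′<q (subst (+ q ∣ᶻ_) (intercept (+ a) (+ b) (+ b′) (+ x))
      (line≡⇒∣- a b a b′ x (trans eqx (cong (λ a → line a b′ x) (sym a≡a′)))))

-- Graph i is assigned the line y = a x + b over ℤ / q with i = (a, b); a vertex in
-- column x goes to the block (x, a x + b).  As two lines meet in at most one point, two
-- graphs share at most one block, in which both are edgeless.
module Construction {t n k q : ℕ} (F : Family t n) (colorable : ∀ i → Colorable k (F i))
  (pq : Prime q) (t≤q² : t ≤ q * q) (w : ℕ) (fits : n + k * w < suc q * suc w)
  where

  private instance
    q≢0 : NonZero q
    q≢0 = prime⇒nonZero pq

  module L (i : Fin t) = Layout (proj₁ (colorable i)) w

  -- Bounds the number of columns that reach level l uniformly over the family, so that all graphs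
  -- share one arrangement of slots.
  width : ℕ → ℕ
  width l = (n + k * (w ∸ l)) / suc w

  capacity : ℕ
  capacity = ∑[ l < suc w ] width (toℕ l)

  -- The purpose of `fits`: column numbers stay below q, so different columns are different
  -- abscissas modulo q.
  width≤q : ∀ l → width l ≤ q
  width≤q l = s≤s⁻¹ (m<n*o⇒m/o<n (≤-<-trans (+-monoʳ-≤ n (*-monoʳ-≤ k (m∸n≤m w l))) fits))

  level≤w : ∀ i v → L.level i v ≤ w
  level≤w i v = s≤s⁻¹ (m%n<n (L.index i v) (suc w))

  column<width : ∀ i v → L.column i v < width (L.level i v)
  column<width i v = <-≤-trans (L.column<columns i v) (begin
    L.columns i l                    ≡⟨ m*n/n≡m (L.columns i l) (suc w) ⟨
    L.columns i l * suc w / suc w    ≤⟨ /-monoˡ-≤ (suc w) (L.columns*s≤ i l (level≤w i v)) ⟩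
    width l                          ∎)
    where
    open ≤-Reasoning
    l = L.level i v

  column<q : ∀ i v → L.column i v < q
  column<q i v = <-≤-trans (column<width i v) (width≤q (L.level i v))

  2*capacity≤ : 2 * capacity ≤ 2 * n + k * w
  2*capacity≤ = *-cancelʳ-≤ _ _ (suc w) (begin
    2 * capacity * suc w
      ≡⟨ *-assoc 2 capacity (suc w) ⟩
    2 * (capacity * suc w)
      ≡⟨ cong (2 *_) (*-distribʳ-sum {suc w} (suc w) (λ l → width (toℕ l))) ⟩
    2 * ∑[ l < suc w ] (width (toℕ l) * suc w)
      ≤⟨ *-monoʳ-≤ 2 (sum-mono-≤ {suc w} (λ l → m/n*n≤m (n + k * (w ∸ toℕ l)) (suc w))) ⟩
    2 * ∑[ l < suc w ] (n + k * (w ∸ toℕ l))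
      ≡⟨ cong (2 *_) (trans (∑-distrib-+ {suc w} (λ _ → n) (λ l → k * (w ∸ toℕ l)))
           (cong₂ _+_ (sum-const (suc w) n) (sym (*-distribˡ-sum {suc w} k (λ l → w ∸ toℕ l))))) ⟩
    2 * (suc w * n + k * ∑[ l < suc w ] (w ∸ toℕ l))
      ≡⟨ regroup (suc w) n k (∑[ l < suc w ] (w ∸ toℕ l)) ⟩
    2 * suc w * n + k * (2 * ∑[ l < suc w ] (w ∸ toℕ l))
      ≡⟨ cong (λ x → 2 * suc w * n + k * x) (triangular w) ⟩
    2 * suc w * n + k * (w * suc w)
      ≡⟨ regroup₂ (suc w) n k w ⟩
    (2 * n + k * w) * suc w ∎)
    where
    open ≤-Reasoning
    regroup : ∀ s n k x → 2 * (s * n + k * x) ≡ 2 * s * n + k * (2 * x)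
    regroup = solve-∀
    regroup₂ : ∀ s n k w → 2 * s * n + k * (w * s) ≡ (2 * n + k * w) * s
    regroup₂ = solve-∀
    triangular : ∀ w → 2 * ∑[ l < suc w ] (w ∸ toℕ l) ≡ w * suc w
    triangular zero    = refl
    triangular (suc w) = trans (*-distribˡ-+ 2 (suc w) _)
      (trans (cong (λ x → 2 * suc w + x) (triangular w)) (expand w))
      where
      expand : ∀ w → 2 * suc w + w * suc w ≡ suc w * suc (suc w)
      expand = solve-∀

  a b : Fin t → Fin q
  a i = proj₁ (remQuot {q} q (inject≤ i t≤q²))
  b i = proj₂ (remQuot {q} q (inject≤ i t≤q²))

  lines-distinct : ∀ {i j} → a i ≡ a j → b i ≡ b j → i ≡ j
  lines-distinct {i} {j} a≡ b≡ = inject≤-injective t≤q² t≤q² i j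
    (trans (sym (combine-remQuot {q} q (inject≤ i t≤q²)))
      (trans (cong₂ combine a≡ b≡) (combine-remQuot {q} q (inject≤ j t≤q²))))

  height : Fin t → Fin n → ℕ
  height i v = line pq (toℕ (a i)) (toℕ (b i)) (L.column i v)

  level : Fin t → Fin n → Fin (suc w)
  level i v = fromℕ< (s≤s (level≤w i v))

  toℕ-level : ∀ i v → toℕ (level i v) ≡ L.level i v
  toℕ-level i v = toℕ-fromℕ< (s≤s (level≤w i v))

  column<width′ : ∀ i v → L.column i v < width (toℕ (level i v))
  column<width′ i v = subst (λ l → L.column i v < width l) (sym (toℕ-level i v)) (column<width i v)

  block : Fin t → Fin n → Fin q
  block i v = fromℕ< (m%n<n (toℕ (a i) * L.column i v + toℕ (b i)) q)

  toℕ-block : ∀ i v → toℕ (block i v) ≡ height i v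
  toℕ-block i v = toℕ-fromℕ< (m%n<n (toℕ (a i) * L.column i v + toℕ (b i)) q)

  widths : Fin (suc w) → ℕ
  widths l = width (toℕ l)

  slot : ∀ i v → Fin (widths (level i v))
  slot i v = fromℕ< (column<width′ i v)

  -- The coordinates are ordinate, level, column. The block (x, y) is not contiguous: within the
  -- y-th stretch of length `capacity` it consists of slot x on every level whose width exceeds x.
  φ : Fin t → Fin n → Fin (q * capacity)
  φ i v = combine (block i v) (offset widths (level i v) (slot i v))

  module _ {i j : Fin t} {u v : Fin n} (eq : φ i u ≡ φ j v) where

    private
      block-slot≡ : block i u ≡ block j v ×
        offset widths (level i u) (slot i u) ≡ offset widths (level j v) (slot j v)
      block-slot≡ = combine-injective (block i u) (offset widths (level i u) (slot i u))
        (block j v) (offset widths (level j v) (slot j v)) eq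

      level-slot≡ : level i u ≡ level j v × toℕ (slot i u) ≡ toℕ (slot j v)
      level-slot≡ = offset-injective widths (level i u) (slot i u) (level j v) (slot j v) (proj₂ block-slot≡)

    φ≡⇒height≡ : height i u ≡ height j v
    φ≡⇒height≡ = trans (sym (toℕ-block i u)) (trans (cong toℕ (proj₁ block-slot≡)) (toℕ-block j v))

    φ≡⇒level≡ : L.level i u ≡ L.level j v
    φ≡⇒level≡ = trans (sym (toℕ-level i u)) (trans (cong toℕ (proj₁ level-slot≡)) (toℕ-level j v))

    φ≡⇒column≡ : L.column i u ≡ L.column j v
    φ≡⇒column≡ = trans (sym (toℕ-fromℕ< (column<width′ i u)))
      (trans (proj₂ level-slot≡) (toℕ-fromℕ< (column<width′ j v)))

  φ-injective : ∀ i {u v} → φ i u ≡ φ i v → u ≡ v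
  φ-injective i {u} {v} eq = L.position-injective i {u} {v}
    (φ≡⇒column≡ {i} {i} {u} {v} eq) (φ≡⇒level≡ {i} {i} {u} {v} eq)

  φ≡⇒line≡ : ∀ {i j u v} → φ i u ≡ φ j v →
    line pq (toℕ (a i)) (toℕ (b i)) (L.column j v) ≡ line pq (toℕ (a j)) (toℕ (b j)) (L.column j v)
  φ≡⇒line≡ {i} {j} {u} {v} eq =
    trans (cong (line pq (toℕ (a i)) (toℕ (b i))) (sym (φ≡⇒column≡ {i} {j} {u} {v} eq)))
      (φ≡⇒height≡ {i} {j} {u} {v} eq)

  φ-disjoint : ∀ {i j u u′ v v′} → i ≢ j → φ i u ≡ φ j u′ → φ i v ≡ φ j v′ → ¬ T (adj (F j) u′ v′)
  φ-disjoint {i} {j} {u} {u′} {v} {v′} i≢j eq eq′ u′v′ = i≢j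
    (lines-distinct (toℕ-injective (proj₁ ab≡)) (toℕ-injective (proj₂ ab≡)))
    where
    -- A column lies inside one colour class, so the ends of an edge are in different columns; lines
    -- that agree over both coincide.
    column≢ : L.column j u′ ≢ L.column j v′
    column≢ = proj₂ (colorable j) u′ v′ u′v′ ∘ L.column≡⇒colour≡ j {u′} {v′}
    ab≡ : toℕ (a i) ≡ toℕ (a j) × toℕ (b i) ≡ toℕ (b j)
    ab≡ = line-injective pq {toℕ (a i)} {toℕ (b i)} {toℕ (a j)} {toℕ (b j)} {L.column j u′} {L.column j v′}
      (toℕ<n (a i)) (toℕ<n (b i)) (toℕ<n (a j)) (toℕ<n (b j))
      (column<q j u′) (column<q j v′) column≢
      (φ≡⇒line≡ {i} {j} {u} {u′} eq) (φ≡⇒line≡ {i} {j} {v} {v′} eq′)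

  𝒰≤q*capacity : 𝒰 F ≤ q * capacity
  𝒰≤q*capacity = 𝒰≤ (Overlay.hasInducedUniversal F φ φ-injective φ-disjoint)

-- The bound

square-cancel-≤ : ∀ {a b} → a * a ≤ b * b → a ≤ b
square-cancel-≤ a²≤b² = ≮⇒≥ λ b<a → <⇒≱ (*-mono-< b<a b<a) a²≤b²

rearrangement : ∀ {a b c d} → a ≤ b → c ≤ d → a * d + b * c ≤ b * d + a * c
rearrangement {a} {b} {c} {d} a≤b c≤d with m≤n⇒∃[o]m+o≡n a≤b | m≤n⇒∃[o]m+o≡n c≤d
... | x , refl | y , refl = subst (a * (c + y) + (a + x) * c ≤_) (expand a c x y) (m≤m+n _ (x * y))
  where
  expand : ∀ a c x y → a * (c + y) + (a + x) * c + x * y ≡ (a + x) * (c + y) + a * c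
  expand = solve-∀

-- 14 d² + 7 k² < 39 k d, that is, d / k lies between the roots 0.19… and 2.59….
cross-term : ∀ {k d} → 0 < k → k ≤ d → 7 * d ≤ 18 * k → 7 * ((k + d) * (2 * d + k)) < 60 * (k * d)
cross-term {k@(suc _)} {d@(suc _)} 0<k k≤d 7d≤18k = *-cancelˡ-< 5 _ _ (begin-strict
  -- Scaled by 5 and enlarged by k², the left side is 70 d² + 36 k² + 105 k d. As (18 k - 7 d)(10 d
  -- - 2 k) ≥ 0, the squares amount to at most 194 k d, in total 299 k d < 300 k d.
  5 * (7 * ((k + d) * (2 * d + k)))             ≤⟨ m≤m+n _ (k * k) ⟩
  5 * (7 * ((k + d) * (2 * d + k))) + k * k     ≡⟨ expand k d ⟩
  (7 * d * (10 * d) + 18 * k * (2 * k)) + 105 * (k * d)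
    ≤⟨ +-monoˡ-≤ (105 * (k * d)) (rearrangement 7d≤18k (*-mono-≤ (m≤m+n 2 8) k≤d)) ⟩
  (18 * k * (10 * d) + 7 * d * (2 * k)) + 105 * (k * d)  <⟨ m<m+n _ (s≤s z≤n) ⟩
  (18 * k * (10 * d) + 7 * d * (2 * k)) + 105 * (k * d) + k * d  ≡⟨ collect k d ⟩
  5 * (60 * (k * d)) ∎)
  where
  open ≤-Reasoning
  expand : ∀ k d → 5 * (7 * ((k + d) * (2 * d + k))) + k * k
    ≡ (7 * d * (10 * d) + 18 * k * (2 * k)) + 105 * (k * d)
  expand = solve-∀
  collect : ∀ k d → (18 * k * (10 * d) + 7 * d * (2 * k)) + 105 * (k * d) + k * d ≡ 5 * (60 * (k * d))
  collect = solve-∀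

-- If 18 k ≤ 7 d, the lower bound √5 q / 4 for √t suffices, otherwise the lower bound 2 k.
main-inequality : ∀ {k d t} → 0 < d → k ≤ d →
  5 * ((k + d) * (k + d)) ≤ 16 * t → 4 * (k * k) ≤ t →
  (7 * ((k + d) * (2 * d + k))) * (7 * ((k + d) * (2 * d + k))) < t * ((30 * d) * (30 * d))
main-inequality {k} {d@(suc _)} {t} 0<d k≤d 5q²≤16t 4k²≤t with ≤-total (18 * k) (7 * d)
... | inj₁ 18k≤7d = *-cancelˡ-< 16 _ _ (begin-strict
  16 * ((7 * (q * e)) * (7 * (q * e)))    ≡⟨ regroup q e ⟩
  q * q * ((28 * e) * (28 * e))           ≤⟨ *-monoʳ-≤ (q * q) (*-mono-≤ 28e≤67d 28e≤67d) ⟩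
  q * q * ((67 * d) * (67 * d))           ≡⟨ cong (q * q *_) (square 67 d) ⟩
  q * q * (67 * 67 * (d * d))
    <⟨ *-monoʳ-< (q * q) {{m*n≢0 q q}} (*-monoˡ-< (d * d) (≤ᵇ⇒≤ (suc (67 * 67)) (30 * 30 * 5) tt)) ⟩
  q * q * (30 * 30 * 5 * (d * d))         ≡⟨ regroup₂ (30 * 30) 5 (q * q) (d * d) ⟩
  30 * 30 * (d * d) * (5 * (q * q))       ≤⟨ *-monoʳ-≤ (30 * 30 * (d * d)) 5q²≤16t ⟩
  30 * 30 * (d * d) * (16 * t)            ≡⟨ cong (_* (16 * t)) (square 30 d) ⟨
  30 * d * (30 * d) * (16 * t)            ≡⟨ regroup₃ (30 * d * (30 * d)) 16 t ⟩
  16 * (t * ((30 * d) * (30 * d)))        ∎)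
  where
  open ≤-Reasoning
  q = k + d
  e = 2 * d + k
  instance
    q≢0 : NonZero q
    q≢0 = >-nonZero (<-≤-trans 0<d (m≤n+m d k))
  -- With √t ≥ √5 q / 4 the goal becomes 28 e < 30 √5 d. Since k ≤ (7/18) d, e ≤ (43/18) d and 28 e
  -- ≤ 66.9 d; rounding up to 67 is safe because 67² = 4489 < 4500 = 30² · 5.
  28e≤67d : 28 * e ≤ 67 * d
  28e≤67d = *-cancelˡ-≤ 18 (begin
    18 * (28 * e)                      ≡⟨ expand k d ⟩
    18 * (56 * d) + 28 * (18 * k)      ≤⟨ +-monoʳ-≤ (18 * (56 * d)) (*-monoʳ-≤ 28 18k≤7d) ⟩
    18 * (56 * d) + 28 * (7 * d)       ≤⟨ m≤m+n _ (2 * d) ⟩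
    18 * (56 * d) + 28 * (7 * d) + 2 * d ≡⟨ collect d ⟩
    18 * (67 * d)                      ∎)
    where
    expand : ∀ k d → 18 * (28 * (2 * d + k)) ≡ 18 * (56 * d) + 28 * (18 * k)
    expand = solve-∀
    collect : ∀ d → 18 * (56 * d) + 28 * (7 * d) + 2 * d ≡ 18 * (67 * d)
    collect = solve-∀
  regroup : ∀ q e → 16 * ((7 * (q * e)) * (7 * (q * e))) ≡ q * q * ((28 * e) * (28 * e))
  regroup = solve-∀
  square : ∀ c d → c * d * (c * d) ≡ c * c * (d * d)
  square = solve-∀
  regroup₂ : ∀ a b x y → x * (a * b * y) ≡ a * y * (b * x)
  regroup₂ = solve-∀
  regroup₃ : ∀ x a t → x * (a * t) ≡ a * (t * x)
  regroup₃ = solve-∀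
... | inj₂ 7d≤18k = begin-strict
  (7 * (q * e)) * (7 * (q * e))       <⟨ *-mono-< lt lt ⟩
  (60 * (k * d)) * (60 * (k * d))     ≡⟨ regroup k d ⟩
  4 * (k * k) * ((30 * d) * (30 * d)) ≤⟨ *-monoˡ-≤ ((30 * d) * (30 * d)) 4k²≤t ⟩
  t * ((30 * d) * (30 * d))           ∎
  where
  open ≤-Reasoning
  q = k + d
  e = 2 * d + k
  0<k : 0 < k
  0<k = n≢0⇒n>0 λ { refl → contradiction 7d≤18k (<⇒≱ (s≤s z≤n)) }
  lt : 7 * (q * e) < 60 * (k * d)
  lt = cross-term 0<k k≤d 7d≤18k
  regroup : ∀ k d → (60 * (k * d)) * (60 * (k * d)) ≡ 4 * (k * k) * ((30 * d) * (30 * d))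
  regroup = solve-∀

-- Squared, so that √t does not occur. Strictness is what calls for n ≥ 1: at n = 0 both sides
-- vanish.
colorable⇒𝒰-bound : ∀ {n k t} → 1 ≤ n → (F : Family t n) → (∀ i → Colorable k (F i)) →
  4 * (k * k) ≤ t → 811 ≤ t → 7 * 𝒰 F * (7 * 𝒰 F) < t * (15 * n * (15 * n))
colorable⇒𝒰-bound {n} {k} {t} 1≤n F colorable 4k²≤t 811≤t = fromPrime (primeAboveSqrt t 811≤t)
  where
  open ≤-Reasoning
  fromPrime : ∃[ q ] (Prime q × t ≤ q * q × 5 * (q * q) ≤ 16 * t) →
    7 * 𝒰 F * (7 * 𝒰 F) < t * (15 * n * (15 * n))
  fromPrime (q , pq , t≤q² , 5q²≤16t) = *-cancelˡ-< (D * D) _ _ (begin-strict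
    D * D * (7 * U * (7 * U))              ≡⟨ regroup D (7 * U) ⟩
    (D * (7 * U)) * (D * (7 * U))          ≤⟨ *-mono-≤ D7U≤nA D7U≤nA ⟩
    (n * A) * (n * A)                      ≡⟨ regroup n A ⟨
    n * n * (A * A)                        <⟨ *-monoʳ-< (n * n) {{m*n≢0 n n}} A²< ⟩
    n * n * (t * ((30 * d) * (30 * d)))    ≡⟨ regroup₂ n t d ⟩
    D * D * (t * (15 * n * (15 * n)))      ∎)
    where
    d D U A w : ℕ
    d = q ∸ k
    D = 2 * d
    U = 𝒰 F
    A = 7 * (q * (2 * d + k))
    -- Since (q + 1)(w + 1) - k w = k + (d + 1)(w + 1), this is the least w that satisfies `fits`.
    w = (n ∸ k) / suc d
    instance
      n≢0 : NonZero n
      n≢0 = >-nonZero 1≤n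
    2k≤q : 2 * k ≤ q
    2k≤q = square-cancel-≤ (≤-trans (≤-reflexive (square k)) (≤-trans 4k²≤t t≤q²))
      where
      square : ∀ k → 2 * k * (2 * k) ≡ 4 * (k * k)
      square = solve-∀
    k≤q : k ≤ q
    k≤q = ≤-trans (m≤m+n k (k + 0)) 2k≤q
    k+d≡q : k + d ≡ q
    k+d≡q = m+[n∸m]≡n k≤q
    k≤d : k ≤ d
    k≤d = +-cancelˡ-≤ k k d (≤-trans (≤-reflexive (cong (λ x → k + x) (sym (+-identityʳ k))))
      (≤-trans 2k≤q (≤-reflexive (sym k+d≡q))))
    0<d : 0 < d
    0<d = n≢0⇒n>0 λ d≡0 → contradiction
      (trans (sym k+d≡q) (cong₂ _+_ (n≤0⇒n≡0 (subst (k ≤_) d≡0 k≤d)) d≡0)) (≢-nonZero⁻¹ q {{prime⇒nonZero pq}})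
    A²< : A * A < t * ((30 * d) * (30 * d))
    A²< = subst (λ x → (7 * (x * (2 * d + k))) * (7 * (x * (2 * d + k))) < t * ((30 * d) * (30 * d))) k+d≡q
      (main-inequality 0<d k≤d (subst (λ x → 5 * (x * x) ≤ 16 * t) (sym k+d≡q) 5q²≤16t) 4k²≤t)
    n∸k< : n ∸ k < suc w * suc d
    n∸k< = begin-strict
      n ∸ k                                ≡⟨ m≡m%n+[m/n]*n (n ∸ k) (suc d) ⟩
      (n ∸ k) % suc d + w * suc d          <⟨ +-monoˡ-< (w * suc d) (m%n<n (n ∸ k) (suc d)) ⟩
      suc w * suc d                        ∎
    fits : n + k * w < suc q * suc w
    fits = begin-strict
      n + k * w                    ≤⟨ +-monoˡ-≤ (k * w) (m≤n+m∸n n k) ⟩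
      k + (n ∸ k) + k * w          <⟨ +-monoˡ-< (k * w) (+-monoʳ-< k n∸k<) ⟩
      k + suc w * suc d + k * w    ≡⟨ regroup₃ k w d ⟩
      suc (k + d) * suc w          ≡⟨ cong (λ x → suc x * suc w) k+d≡q ⟩
      suc q * suc w                ∎
      where
      regroup₃ : ∀ k w d → k + suc w * suc d + k * w ≡ suc (k + d) * suc w
      regroup₃ = solve-∀
    wd≤n : w * d ≤ n
    wd≤n = ≤-trans (*-monoʳ-≤ w (n≤1+n d)) (≤-trans (m/n*n≤m (n ∸ k) (suc d)) (m∸n≤m n k))
    open Construction F colorable pq t≤q² w fits using (capacity; 2*capacity≤; 𝒰≤q*capacity)
    D7U≤nA : D * (7 * U) ≤ n * A
    D7U≤nA = begin
      2 * d * (7 * U)                    ≤⟨ *-monoʳ-≤ (2 * d) (*-monoʳ-≤ 7 𝒰≤q*capacity) ⟩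
      2 * d * (7 * (q * capacity))       ≡⟨ regroup₄ d q capacity ⟩
      7 * q * d * (2 * capacity)         ≤⟨ *-monoʳ-≤ (7 * q * d) 2*capacity≤ ⟩
      7 * q * d * (2 * n + k * w)        ≡⟨ regroup₅ q d n k w ⟩
      7 * q * (2 * n * d + k * (w * d))  ≤⟨ *-monoʳ-≤ (7 * q) (+-monoʳ-≤ (2 * n * d) (*-monoʳ-≤ k wd≤n)) ⟩
      7 * q * (2 * n * d + k * n)        ≡⟨ regroup₆ q n d k ⟩
      n * (7 * (q * (2 * d + k)))        ∎
      where
      regroup₄ : ∀ d q c → 2 * d * (7 * (q * c)) ≡ 7 * q * d * (2 * c)
      regroup₄ = solve-∀
      regroup₅ : ∀ q d n k w → 7 * q * d * (2 * n + k * w) ≡ 7 * q * (2 * n * d + k * (w * d))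
      regroup₅ = solve-∀
      regroup₆ : ∀ q n d k → 7 * q * (2 * n * d + k * n) ≡ n * (7 * (q * (2 * d + k)))
      regroup₆ = solve-∀
    regroup : ∀ x y → x * x * (y * y) ≡ (x * y) * (x * y)
    regroup = solve-∀
    regroup₂ : ∀ n t d → n * n * (t * ((30 * d) * (30 * d))) ≡ 2 * d * (2 * d) * (t * (15 * n * (15 * n)))
    regroup₂ = solve-∀

theorem6 : (n k p t : ℕ) → 1 ≤ n →
    + p *ᶻ (+ (k ^ 2) -ᶻ 1ℤ) ≤ᶻ + n →
    (F : Family t n) →
    (∀ i → Colorable k (F i)) →
    (∀ i → PathwidthAtMost p (F i)) →
    (4 * k ^ 2) ⊔ 811 ≤ t →
    (7 * 𝒰 F) ^ 2 < t * (15 * n) ^ 2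
theorem6 n k p t 1≤n _ F colorable _ t-large =
  subst₂ (λ x y → x < t * y) (square (7 * 𝒰 F)) (square (15 * n))
    (colorable⇒𝒰-bound 1≤n F colorable
      (subst (λ x → 4 * x ≤ t) (sym (square k)) (m⊔n≤o⇒m≤o (4 * k ^ 2) 811 t-large))
      (m⊔n≤o⇒n≤o (4 * k ^ 2) 811 t-large))
  where
  square : ∀ x → x * x ≡ x ^ 2
  square x = cong (x *_) (sym (*-identityʳ x))
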